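{- For each integer $n \ge 0$, let $d_n$ be the smallest positive integer such that $d_n \cdot (1^n + 2^n + \cdots + x^n)$ is a polynomial in $x$ with integer coefficients (here $1^n+2^n+\cdots+x^n$ denotes the unique polynomial in $\mathbb{Q}[x]$ of degree $n+1$ agreeing with this sum for all positive integers $x$). Then, with $p$ always denoting a prime: (i) if $p \mid d_n$ then $p \le n+1$; (ii) $d_n$ is divisible by $n+1$, and the quotient $q_n := d_n/(n+1)$ is squarefree; (iii) $d_n$ is even for all $n \ge 1$, while $q_n$ is odd if and only if $n = 2^r - 1$ for some integer $r \ge 0$; (iv) if $p \mid q_n$ then $p \le M_n$, where $M_n := \frac{n+2}{2}$ if $n$ is even and $M_n := \frac{n+2}{3}$ if $n$ is odd. -}

module Defs where

open import Data.Nat using (ℕ; zero; suc; _+_; _*_; _^_; _<_)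
open import Data.Nat.Divisibility using (_∣_)
open import Data.Integer using (ℤ; +_)
open import Data.Rational as ℚ using (ℚ; _/_)
open import Data.Vec using (Vec; []; _∷_)
open import Data.Vec.Relation.Unary.All using (All)
open import Data.Product using (∃; _×_)
open import Relation.Binary.PropositionalEquality using (_≡_)

ℕ→ℚ : ℕ → ℚ
ℕ→ℚ x = + x / 1

ℤ→ℚ : ℤ → ℚ
ℤ→ℚ z = z / 1

powerSum : ℕ → ℕ → ℕ
powerSum n zero    = 0
powerSum n (suc x) = powerSum n x + suc x ^ n

-- polynomial with coefficient vector c = (c₀, c₁, …, c_m) (constant term first),
-- evaluated at t by Horner's rule:  c₀ + c₁ t + … + c_m t^m
evalPoly : ∀ {m} → Vec ℚ m → ℚ → ℚ
evalPoly []       t = ℚ.0ℚ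
evalPoly (a ∷ cs) t = a ℚ.+ t ℚ.* evalPoly cs t

IsInteger : ℚ → Set
IsInteger q = ∃ λ (z : ℤ) → q ≡ ℤ→ℚ z

ClearsDenominators : ∀ {m} → Vec ℚ m → ℕ → Set
ClearsDenominators c d = All (λ a → IsInteger (ℤ→ℚ (+ d) ℚ.* a)) c

IsLeastDenominator : ∀ {m} → Vec ℚ m → ℕ → Set
IsLeastDenominator c d =
  0 < d × ClearsDenominators c d ×
  (∀ d′ → 0 < d′ → ClearsDenominators c d′ → d Data.Nat.≤ d′)

Squarefree : ℕ → Set
Squarefree q = ∀ m → m * m ∣ q → m ≡ 1

{-# OPTIONS --safe #-}
-- Let S(n,k) be the Stirling numbers of the second kind. In a basis of falling factorials the power
-- sum has, up to integers, the coefficients S(n,k)/(k+1), so d clears its denominators if and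
-- only if k+1 ∣ d S(n,k) for all k; k = n gives n+1 ∣ d, and q = d/(n+1) is the common denominator
-- of the numbers A(k) = (n+1) S(n,k)/(k+1). Expanding z = log (1 + (eᶻ − 1)) in z (eᶻ − 1)ᵏ yields
--   A(k) = Σᵢ (−1)ⁱ · C(k+1+i, i) · i!/(i+1) · S(n+1, k+1+i).
-- Since p · i!/(i+1) is p-integral, so is p A(k), and q is squarefree. If A(k) is not p-integral,
-- then p ∣ k+1 and p ∣ i+1 for some i with k+1+i ≤ n+1, whence 2p ≤ n+2. If n is odd, the
-- boundary case k+1 = i+1 = p does not occur, because then p ∣ S(n+1, 2p−1) by a reflection of the
-- complete symmetric function S(n+1, 2p−1) = h(1, …, 2p−1); so 3p ≤ n+2. For p = 2, q is odd
-- if and only if all S(n+1, 2u+1) with u ≥ 1 are even. Modulo 2 these are the coefficients of a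
-- Fibonacci polynomial f with f₂ₘ = fₘ², which is constant exactly when n+1 is a power of 2.
module Submission where

open import Defs
open import Data.Nat using (ℕ; zero; suc; _+_; _*_; _^_; _∸_; _≤_; _<_; _/_; _!; _≤?_; z≤n; s≤s; s≤s⁻¹; parity; NonZero; nonTrivial⇒n>1)
import Data.Nat.Properties as ℕ
open import Data.Nat.Combinatorics using (_C_; nCk≡n!/k![n-k]!; k![n∸k]!∣n!; nC1≡n)
open import Data.Nat.Coprimality using (Coprime; coprime-factors)
open import Data.Nat.Divisibility
open import Data.Nat.DivMod using (m*n/n≡m; m/n*n≡m)
open import Data.Nat.Induction using (<-rec)
open import Data.Nat.Primality using (Prime; euclidsLemma; prime⇒nonZero; prime⇒nonTrivial; prime⇒irreducible; ¬prime[1]; prime[2])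
open import Data.Nat.Primality.Factorisation using (factorise)
import Data.Nat.Tactic.RingSolver as ℕ-Solver
open import Data.Integer as ℤ using (ℤ; +_)
import Data.Integer.Properties as ℤ
import Data.Integer.Tactic.RingSolver as ℤ-Solver
open import Data.List using (List; []; _∷_; map)
open import Data.List.Relation.Unary.All using ([]; _∷_)
open import Data.List.Relation.Binary.Permutation.Propositional as ↭ using (_↭_; prep; swap)
open import Data.Parity as ℙ using (Parity; 0ℙ; 1ℙ)
import Data.Parity.Properties as ℙ
open import Data.Product using (∃; _×_; _,_; proj₁; proj₂; map₂)
open import Data.Rational as ℚ using (ℚ; 0ℚ; 1ℚ)
import Data.Rational.Properties as ℚ
import Algebra.Properties.Group ℚ.+-0-group as ℚ+
open import Data.Rational.Solver using (module +-*-Solver)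
open +-*-Solver using (solve; _:+_; _:*_; :-_; _:-_; _:=_; con)
open import Data.Rational.Unnormalised as ℚᵘ using (mkℚᵘ; *≡*)
import Data.Rational.Unnormalised.Properties as ℚᵘ
open import Data.Sum using (inj₁; inj₂; [_,_]′)
open import Data.Vec using (Vec; []; _∷_)
open import Data.Vec.Relation.Unary.All using ([]; _∷_)
open import Function using (_∘_)
open import Function.Bundles using (_⇔_; mk⇔)
open import Relation.Nullary using (¬_; Dec; yes; no; contradiction)
open import Relation.Binary.PropositionalEquality using (_≡_; refl; sym; trans; cong; cong₂; subst; module ≡-Reasoning)
open ≡-Reasoning

-- Stirling numbers

-- stirling r n k is the coefficient of the falling factorial (z)ₖ in (z + r)ⁿ.
stirling : ℕ → ℕ → ℕ → ℕ
stirling r zero    zero    = 1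
stirling r zero    (suc k) = 0
stirling r (suc n) zero    = r * stirling r n zero
stirling r (suc n) (suc k) = stirling r n k + (r + suc k) * stirling r n (suc k)

S : ℕ → ℕ → ℕ
S = stirling 0

-- Replacing z by z + 1 turns (z)ₖ₊₁ into (z)ₖ₊₁ + (k + 1)(z)ₖ. Modulo k + 1 the entry of index k
-- therefore does not depend on `r`.
stirling-shift : ∀ r n k →
  stirling (suc r) n k ≡ stirling r n k + suc k * stirling r n (suc k)
stirling-shift r zero    zero    = refl
stirling-shift r zero    (suc k) = sym (ℕ.*-zeroʳ (suc (suc k)))
stirling-shift r (suc n) zero    = trans (cong (suc r *_) (stirling-shift r n 0))
  (identity r (stirling r n 0) (stirling r n 1))
  where
  identity : ∀ r s t → suc r * (s + 1 * t) ≡ r * s + 1 * (s + (r + 1) * t)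
  identity = ℕ-Solver.solve-∀
stirling-shift r (suc n) (suc k) = trans
  (cong₂ (λ x y → x + (suc r + suc k) * y) (stirling-shift r n k) (stirling-shift r n (suc k)))
  (identity r k (stirling r n k) (stirling r n (suc k)) (stirling r n (suc (suc k))))
  where
  identity : ∀ r k s t v →
    (s + suc k * t) + (suc r + suc k) * (t + suc (suc k) * v) ≡
    (s + (r + suc k) * t) + suc (suc k) * (t + (r + suc (suc k)) * v)
  identity = ℕ-Solver.solve-∀

stirling-above : ∀ r {n k} → n < k → stirling r n k ≡ 0
stirling-above r {zero}  {suc k} _         = refl
stirling-above r {suc n} {suc k} (s≤s n<k)
  rewrite stirling-above r n<k | stirling-above r (ℕ.m<n⇒m<1+n n<k) = ℕ.*-zeroʳ (r + suc k)

stirling-diagonal : ∀ r n → stirling r n n ≡ 1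
stirling-diagonal r zero    = refl
stirling-diagonal r (suc n)
  rewrite stirling-diagonal r n | stirling-above r (ℕ.n<1+n n) = cong suc (ℕ.*-zeroʳ (r + suc n))

-- Complete symmetric polynomials and reflection

-- h as s is the complete homogeneous symmetric polynomial of degree s in as.
h : List ℤ → ℕ → ℤ
h as       zero    = + 1
h []       (suc s) = + 0
h (a ∷ as) (suc s) = h as (suc s) ℤ.+ a ℤ.* h (a ∷ as) s

h-cong-∷ : ∀ a {as bs} → (∀ s → h as s ≡ h bs s) → ∀ s → h (a ∷ as) s ≡ h (a ∷ bs) s
h-cong-∷ a as≗bs zero    = refl
h-cong-∷ a as≗bs (suc s) =
  cong₂ (λ x y → x ℤ.+ a ℤ.* y) (as≗bs (suc s)) (h-cong-∷ a as≗bs s)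

-- Both sides obey a two-step recurrence in the degree with the symmetric coefficients a + b and
-- -ab, so the induction uses the two preceding degrees.
h-swap : ∀ a b as s → h (a ∷ b ∷ as) s ≡ h (b ∷ a ∷ as) s
h-swap a b as zero          = refl
h-swap a b as (suc zero)    = identity a b (h as 1)
  where
  identity : ∀ a b w → (w ℤ.+ b ℤ.* + 1) ℤ.+ a ℤ.* + 1 ≡ (w ℤ.+ a ℤ.* + 1) ℤ.+ b ℤ.* + 1
  identity = ℤ-Solver.solve-∀
h-swap a b as (suc (suc s)) = identity a b (h as (2 + s)) (h (b ∷ as) (suc s)) (h (a ∷ as) (suc s))
  (h (a ∷ b ∷ as) s) (h (b ∷ a ∷ as) s) (h-swap a b as s) (h-swap a b as (suc s))
  where
  rearrange₁ : ∀ a b w x u → (w ℤ.+ b ℤ.* x) ℤ.+ a ℤ.* (x ℤ.+ a ℤ.* u) ≡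
    w ℤ.+ (a ℤ.+ b) ℤ.* (x ℤ.+ a ℤ.* u) ℤ.- a ℤ.* b ℤ.* u
  rearrange₁ = ℤ-Solver.solve-∀
  rearrange₂ : ∀ a b w y u → w ℤ.+ (a ℤ.+ b) ℤ.* (y ℤ.+ b ℤ.* u) ℤ.- a ℤ.* b ℤ.* u ≡
    (w ℤ.+ a ℤ.* y) ℤ.+ b ℤ.* (y ℤ.+ b ℤ.* u)
  rearrange₂ = ℤ-Solver.solve-∀
  identity : ∀ a b w x y u v → u ≡ v → x ℤ.+ a ℤ.* u ≡ y ℤ.+ b ℤ.* v →
    (w ℤ.+ b ℤ.* x) ℤ.+ a ℤ.* (x ℤ.+ a ℤ.* u) ≡ (w ℤ.+ a ℤ.* y) ℤ.+ b ℤ.* (y ℤ.+ b ℤ.* v)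
  identity a b w x y u .u refl eq = trans (rearrange₁ a b w x u)
    (trans (cong (λ v → w ℤ.+ (a ℤ.+ b) ℤ.* v ℤ.- a ℤ.* b ℤ.* u) eq) (rearrange₂ a b w y u))

h-↭ : ∀ {as bs} → as ↭ bs → ∀ s → h as s ≡ h bs s
h-↭ ↭.refl                   s = refl
h-↭ (prep a as↭bs)           s = h-cong-∷ a (h-↭ as↭bs) s
h-↭ (swap {as} a b as↭bs)    s =
  trans (h-swap a b as s) (h-cong-∷ b (h-cong-∷ a (h-↭ as↭bs)) s)
h-↭ (↭.trans as↭bs bs↭cs)    s = trans (h-↭ as↭bs s) (h-↭ bs↭cs s)

descending : ℕ → List ℤ
descending zero    = []
descending (suc k) = + suc k ∷ descending k

ascendingFrom : ℤ → ℕ → List ℤ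
ascendingFrom a zero    = []
ascendingFrom a (suc k) = a ∷ ascendingFrom (+ 1 ℤ.+ a) k

ascendingFrom-last : ∀ a k → ascendingFrom a (suc k) ↭ + k ℤ.+ a ∷ ascendingFrom a k
ascendingFrom-last a zero    rewrite ℤ.+-identityˡ a = ↭.refl
ascendingFrom-last a (suc k) = ↭.trans (prep a (ascendingFrom-last (+ 1 ℤ.+ a) k))
  (subst (λ b → a ∷ (+ k ℤ.+ (+ 1 ℤ.+ a)) ∷ ascendingFrom (+ 1 ℤ.+ a) k ↭ b ∷ ascendingFrom a (suc k))
    (identity (+ k) a) (swap a _ ↭.refl))
  where
  identity : ∀ k a → k ℤ.+ (+ 1 ℤ.+ a) ≡ (+ 1 ℤ.+ k) ℤ.+ a
  identity = ℤ-Solver.solve-∀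

ascending↭descending : ∀ k → ascendingFrom (+ 1) k ↭ descending k
ascending↭descending zero    = ↭.refl
ascending↭descending (suc k) = ↭.trans (ascendingFrom-last (+ 1) k)
  (subst (λ b → + k ℤ.+ + 1 ∷ ascendingFrom (+ 1) k ↭ b ∷ descending k)
    (cong +_ (ℕ.+-comm k 1)) (prep _ (ascending↭descending k)))

-- The offset `a` serves the induction: when the head is dropped, a + (k + 2) is read as (1 + a) +
-- (k + 1). The application has a = 0.
reflect-descending : ∀ a k →
  map (λ b → (a ℤ.+ + suc k) ℤ.- b) (descending k) ≡ ascendingFrom (+ 1 ℤ.+ a) k
reflect-descending a zero    = refl
reflect-descending a (suc k) = cong₂ _∷_ (identity₁ a (+ k)) (begin
  map (λ b → (a ℤ.+ + suc (suc k)) ℤ.- b) (descending k)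
    ≡⟨ cong (λ c → map (λ b → c ℤ.- b) (descending k)) (identity₂ a (+ k)) ⟩
  map (λ b → ((+ 1 ℤ.+ a) ℤ.+ + suc k) ℤ.- b) (descending k)
    ≡⟨ reflect-descending (+ 1 ℤ.+ a) k ⟩
  ascendingFrom (+ 1 ℤ.+ (+ 1 ℤ.+ a)) k ∎)
  where
  identity₁ : ∀ a k → (a ℤ.+ (+ 1 ℤ.+ (+ 1 ℤ.+ k))) ℤ.- (+ 1 ℤ.+ k) ≡ + 1 ℤ.+ a
  identity₁ = ℤ-Solver.solve-∀
  identity₂ : ∀ a k → a ℤ.+ (+ 1 ℤ.+ (+ 1 ℤ.+ k)) ≡ (+ 1 ℤ.+ a) ℤ.+ (+ 1 ℤ.+ k)
  identity₂ = ℤ-Solver.solve-∀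

alternate : ℕ → ℤ
alternate zero    = + 1
alternate (suc s) = ℤ.- alternate s

-- Modulo M each M - b is -b, and `h` is homogeneous of degree `s`; `t` is the cofactor of M.
h-reflect : ∀ M as s → ∃ λ t →
  h (map (λ b → M ℤ.- b) as) s ≡ alternate s ℤ.* h as s ℤ.+ M ℤ.* t
h-reflect M as       zero    = + 0 , sym (trans (cong (ℤ._+_ (+ 1)) (ℤ.*-zeroʳ M)) refl)
h-reflect M []       (suc s) = + 0 , identity M (alternate (suc s))
  where
  identity : ∀ M e → + 0 ≡ e ℤ.* + 0 ℤ.+ M ℤ.* + 0
  identity = ℤ-Solver.solve-∀
h-reflect M (a ∷ as) (suc s) with h-reflect M as (suc s) | h-reflect M (a ∷ as) s
... | t₁ , eq₁ | t₂ , eq₂ = _ , trans (cong₂ (λ x y → x ℤ.+ (M ℤ.- a) ℤ.* y) eq₁ eq₂)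
  (identity M a (alternate s) (h as (suc s)) (h (a ∷ as) s) t₁ t₂)
  where
  identity : ∀ M a e x y t₁ t₂ →
    (ℤ.- e ℤ.* x ℤ.+ M ℤ.* t₁) ℤ.+ (M ℤ.- a) ℤ.* (e ℤ.* y ℤ.+ M ℤ.* t₂) ≡
    ℤ.- e ℤ.* (x ℤ.+ a ℤ.* y) ℤ.+ M ℤ.* (t₁ ℤ.+ (e ℤ.* y ℤ.+ (M ℤ.- a) ℤ.* t₂))
  identity = ℤ-Solver.solve-∀

-- Both sides have the same recursion: a monomial in 1, ..., k + 1 either omits k + 1 or has it as a
-- factor.
stirling≡h : ∀ k s → + S (k + s) k ≡ h (descending k) s
stirling≡h zero    zero    = refl
stirling≡h zero    (suc s) = refl
stirling≡h (suc k) zero    = cong +_ (trans (cong (λ n → S n (suc k)) (ℕ.+-identityʳ (suc k)))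
  (stirling-diagonal 0 (suc k)))
stirling≡h (suc k) (suc s) = begin
  + (S (k + suc s) k + suc k * S (k + suc s) (suc k))
    ≡⟨ cong (λ n → + (S (k + suc s) k + suc k * S n (suc k))) (ℕ.+-suc k s) ⟩
  + (S (k + suc s) k + suc k * S (suc k + s) (suc k))
    ≡⟨ cong (ℤ._+_ (+ S (k + suc s) k)) (ℤ.pos-* (suc k) (S (suc k + s) (suc k))) ⟩
  + S (k + suc s) k ℤ.+ + suc k ℤ.* + S (suc k + s) (suc k)
    ≡⟨ cong₂ (λ x y → x ℤ.+ + suc k ℤ.* y) (stirling≡h k (suc s)) (stirling≡h (suc k) s) ⟩
  h (descending (suc k)) (suc s) ∎

alternate-odd : ∀ s → alternate (suc (s * 2)) ≡ ℤ.- + 1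
alternate-odd zero    = refl
alternate-odd (suc s) = trans (ℤ.neg-involutive _) (alternate-odd s)

-- The reflection b ↦ k + 1 − b permutes 1, …, k and is negation modulo k + 1.
suc∣2*stirling : ∀ k s → suc k ∣ 2 * S (k + suc (s * 2)) k
suc∣2*stirling k s with h-reflect (+ suc k) (descending k) (suc (s * 2))
... | t , eq = divides ℤ.∣ t ∣ (begin
    2 * x                            ≡⟨ ℤ.abs-* (+ 2) (+ x) ⟨
    ℤ.∣ + 2 ℤ.* + x ∣                ≡⟨ cong ℤ.∣_∣ (identity (+ x) (+ suc k ℤ.* t) sum≡) ⟩
    ℤ.∣ + suc k ℤ.* t ∣              ≡⟨ ℤ.abs-* (+ suc k) t ⟩
    suc k * ℤ.∣ t ∣                  ≡⟨ ℕ.*-comm (suc k) ℤ.∣ t ∣ ⟩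
    ℤ.∣ t ∣ * suc k                  ∎)
  where
  x = S (k + suc (s * 2)) k
  reflected : + x ≡ h (map (λ b → + suc k ℤ.- b) (descending k)) (suc (s * 2))
  reflected = begin
    + x ≡⟨ stirling≡h k (suc (s * 2)) ⟩
    h (descending k) (suc (s * 2)) ≡⟨ h-↭ (ascending↭descending k) (suc (s * 2)) ⟨
    h (ascendingFrom (+ 1) k) (suc (s * 2))
      ≡⟨ cong (λ as → h as (suc (s * 2))) (reflect-descending (+ 0) k) ⟨
    h (map (λ b → + suc k ℤ.- b) (descending k)) (suc (s * 2)) ∎
  sum≡ : + x ≡ ℤ.- + 1 ℤ.* + x ℤ.+ + suc k ℤ.* t
  sum≡ = trans reflected (trans eq (cong₂ (λ e y → e ℤ.* y ℤ.+ + suc k ℤ.* t)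
    (alternate-odd s) (sym (stirling≡h k (suc (s * 2))))))
  double : ∀ x → + 2 ℤ.* x ≡ x ℤ.+ x
  double = ℤ-Solver.solve-∀
  cancel : ∀ x y → x ℤ.+ (ℤ.- + 1 ℤ.* x ℤ.+ y) ≡ y
  cancel = ℤ-Solver.solve-∀
  identity : ∀ x y → x ≡ ℤ.- + 1 ℤ.* x ℤ.+ y → + 2 ℤ.* x ≡ y
  identity x y eq = trans (double x) (trans (cong (ℤ._+_ x) eq) (cancel x y))

-- Parity of Stirling numbers

-- Fibonacci polynomials over 𝔽₂: fibonacci n u is the coefficient of wᵘ in fₙ,
-- where f₀ = 0, f₁ = 1 and fₙ₊₂ = fₙ₊₁ + w fₙ.
fibonacci : ℕ → ℕ → Parity
fibonacci zero          u       = 0ℙ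
fibonacci (suc zero)    zero    = 1ℙ
fibonacci (suc zero)    (suc u) = 0ℙ
fibonacci (suc (suc n)) zero    = fibonacci (suc n) zero
fibonacci (suc (suc n)) (suc u) = fibonacci (suc n) (suc u) ℙ.+ fibonacci n u

parity-double : ∀ n → parity (n * 2) ≡ 0ℙ
parity-double zero    = refl
parity-double (suc n) = parity-double n

parity-suc-double : ∀ n → parity (suc (n * 2)) ≡ 1ℙ
parity-suc-double zero    = refl
parity-suc-double (suc n) = parity-suc-double n

-- Modulo 2 the recursion gives S(n + 1, 2u + 2) ≡ S(n, 2u + 1), because its multiplier is even.
-- Inserted into the recursion at the odd index 2u + 3, this is the Fibonacci recurrence.
stirling-parity : ∀ n u → parity (S n (suc (u * 2))) ≡ fibonacci n u
stirling-parity zero          u       = refl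
stirling-parity (suc zero)    zero    = refl
stirling-parity (suc zero)    (suc u) = trans (cong parity (ℕ.*-zeroʳ (suc (suc u * 2)))) refl
stirling-parity (suc (suc n)) zero    = trans (cong parity (ℕ.*-identityˡ (S (suc n) 1)))
  (stirling-parity (suc n) zero)
stirling-parity (suc (suc n)) (suc u) = begin
  parity (a + suc (suc u * 2) * b)  ≡⟨ ℙ.+-homo-+ a (suc (suc u * 2) * b) ⟩
  parity a ℙ.+ parity (suc (suc u * 2) * b) ≡⟨ cong₂ ℙ._+_ even odd ⟩
  parity (S n (suc (u * 2))) ℙ.+ parity b
    ≡⟨ cong₂ ℙ._+_ (stirling-parity n u) (stirling-parity (suc n) (suc u)) ⟩
  fibonacci n u ℙ.+ fibonacci (suc n) (suc u) ≡⟨ ℙ.+-comm (fibonacci n u) _ ⟩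
  fibonacci (suc n) (suc u) ℙ.+ fibonacci n u ∎
  where
  a = S (suc n) (suc u * 2)
  b = S (suc n) (suc (suc u * 2))
  even : parity a ≡ parity (S n (suc (u * 2)))
  even = begin
    parity a ≡⟨ ℙ.+-homo-+ (S n (suc (u * 2))) _ ⟩
    parity (S n (suc (u * 2))) ℙ.+ parity (suc u * 2 * S n (suc u * 2))
      ≡⟨ cong (parity (S n (suc (u * 2))) ℙ.+_) (trans (ℙ.*-homo-* (suc u * 2) (S n (suc u * 2)))
           (cong (ℙ._* parity (S n (suc u * 2))) (parity-double (suc u)))) ⟩
    parity (S n (suc (u * 2))) ℙ.+ 0ℙ ≡⟨ ℙ.+-identityʳ _ ⟩
    parity (S n (suc (u * 2))) ∎
  odd : parity (suc (suc u * 2) * b) ≡ parity b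
  odd = trans (ℙ.*-homo-* (suc (suc u * 2)) b) (cong (ℙ._* parity b) (parity-suc-double (suc u)))

-- f₂ₙ = fₙ² and f₂ₙ₊₁ = fₙ₊₁² + w fₙ².
fibonacci-even-even : ∀ n u → fibonacci (n * 2) (u * 2) ≡ fibonacci n u
fibonacci-even-odd  : ∀ n u → fibonacci (n * 2) (suc (u * 2)) ≡ 0ℙ
fibonacci-odd-even  : ∀ n u → fibonacci (suc (n * 2)) (u * 2) ≡ fibonacci (suc n) u
fibonacci-odd-odd   : ∀ n u → fibonacci (suc (n * 2)) (suc (u * 2)) ≡ fibonacci n u
fibonacci-even-even zero    u       = refl
fibonacci-even-even (suc n) zero    = fibonacci-odd-even n zero
fibonacci-even-even (suc n) (suc u)
  rewrite fibonacci-odd-even n (suc u) | fibonacci-even-odd n u = ℙ.+-identityʳ _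
fibonacci-even-odd  zero    u       = refl
fibonacci-even-odd  (suc n) u
  rewrite fibonacci-odd-odd n u | fibonacci-even-even n u = ℙ.p+p≡0ℙ (fibonacci n u)
fibonacci-odd-even  zero    zero    = refl
fibonacci-odd-even  zero    (suc u) = refl
fibonacci-odd-even  (suc n) zero    = fibonacci-odd-even n zero
fibonacci-odd-even  (suc n) (suc u) =
  cong₂ ℙ._+_ (fibonacci-even-even (suc n) (suc u)) (fibonacci-odd-odd n u)
fibonacci-odd-odd   zero    u       = refl
fibonacci-odd-odd   (suc n) u       =
  cong₂ ℙ._+_ (fibonacci-even-odd (suc n) u) (fibonacci-odd-even n u)

data Halved : ℕ → Set where
  even : ∀ k → Halved (k * 2)
  odd  : ∀ k → Halved (suc (k * 2))

halve : ∀ n → Halved n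
halve zero    = even 0
halve (suc n) with halve n
... | even k = odd k
... | odd k  = even (suc k)

-- Here f₁ = 1, and passing from m to 2m squares fₘ, which keeps it constant.
fibonacci-2^r : ∀ r u → fibonacci (2 ^ r) (suc u) ≡ 0ℙ
fibonacci-2^r zero    u = refl
fibonacci-2^r (suc r) u rewrite ℕ.*-comm 2 (2 ^ r) with halve u
... | even v = fibonacci-even-odd (2 ^ r) v
... | odd v  = trans (fibonacci-even-even (2 ^ r) (suc v)) (fibonacci-2^r r v)

fibonacci-constantTerm : ∀ n → fibonacci (suc n) 0 ≡ 1ℙ
fibonacci-constantTerm zero    = refl
fibonacci-constantTerm (suc n) = fibonacci-constantTerm n

-- If n = 2m, then fₙ = fₘ², so fₘ is constant too and the argument descends to m. If n = 2m + 1
-- with m ≥ 1, the coefficient of w in fₙ is the constant term 1 of fₘ, a contradiction.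
fibonacci-constant⇒2^r : ∀ n → 0 < n → (∀ u → fibonacci n (suc u) ≡ 0ℙ) → ∃ λ r → n ≡ 2 ^ r
fibonacci-constant⇒2^r = <-rec _ step
  where
  step : ∀ n → (∀ {m} → m < n → 0 < m → (∀ u → fibonacci m (suc u) ≡ 0ℙ) → ∃ λ r → m ≡ 2 ^ r) →
         0 < n → (∀ u → fibonacci n (suc u) ≡ 0ℙ) → ∃ λ r → n ≡ 2 ^ r
  step n rec 0<n constant with halve n
  step _ rec 0<n constant | even (suc k)
    with rec (ℕ.m<m*n (suc k) 2 (s≤s (s≤s z≤n))) (s≤s z≤n)
             (λ u → trans (sym (fibonacci-even-even (suc k) (suc u))) (constant (suc (u * 2))))
  ... | r , eq = suc r , trans (cong (_* 2) eq) (ℕ.*-comm (2 ^ r) 2)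
  step _ rec 0<n constant | odd zero    = 0 , refl
  step _ rec 0<n constant | odd (suc k) with () ← trans (sym (constant 0))
    (trans (fibonacci-odd-odd (suc k) 0) (fibonacci-constantTerm k))

-- Newton expansion of the power sum

ℤ→ℚ-+ : ∀ a b → ℤ→ℚ (a ℤ.+ b) ≡ ℤ→ℚ a ℚ.+ ℤ→ℚ b
ℤ→ℚ-+ a b = ℚ.toℚᵘ-injective (ℚᵘ.≃-trans (ℚ.toℚᵘ-fromℚᵘ (mkℚᵘ (a ℤ.+ b) 0)) (ℚᵘ.≃-sym
  (ℚᵘ.≃-trans (ℚ.toℚᵘ-homo-+ (ℤ→ℚ a) (ℤ→ℚ b))
  (ℚᵘ.≃-trans (ℚᵘ.+-cong (ℚ.toℚᵘ-fromℚᵘ (mkℚᵘ a 0)) (ℚ.toℚᵘ-fromℚᵘ (mkℚᵘ b 0)))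
  (*≡* (cong (ℤ._* + 1) (cong₂ ℤ._+_ (ℤ.*-identityʳ a) (ℤ.*-identityʳ b))))))))

ℤ→ℚ-* : ∀ a b → ℤ→ℚ (a ℤ.* b) ≡ ℤ→ℚ a ℚ.* ℤ→ℚ b
ℤ→ℚ-* a b = ℚ.toℚᵘ-injective (ℚᵘ.≃-trans (ℚ.toℚᵘ-fromℚᵘ (mkℚᵘ (a ℤ.* b) 0)) (ℚᵘ.≃-sym
  (ℚᵘ.≃-trans (ℚ.toℚᵘ-homo-* (ℤ→ℚ a) (ℤ→ℚ b))
  (ℚᵘ.*-cong (ℚ.toℚᵘ-fromℚᵘ (mkℚᵘ a 0)) (ℚ.toℚᵘ-fromℚᵘ (mkℚᵘ b 0))))))

ℤ→ℚ-injective : ∀ {a b} → ℤ→ℚ a ≡ ℤ→ℚ b → a ≡ b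
ℤ→ℚ-injective {a} {b} eq
  with *≡* eq′ ← ℚᵘ.≃-trans (ℚᵘ.≃-sym (ℚ.toℚᵘ-fromℚᵘ (mkℚᵘ a 0)))
    (ℚᵘ.≃-trans (ℚᵘ.≃-reflexive (cong ℚ.toℚᵘ eq)) (ℚ.toℚᵘ-fromℚᵘ (mkℚᵘ b 0)))
  = ℤ.*-cancelʳ-≡ a b (+ 1) eq′

ℕ→ℚ-+ : ∀ a b → ℕ→ℚ (a + b) ≡ ℕ→ℚ a ℚ.+ ℕ→ℚ b
ℕ→ℚ-+ a b = ℤ→ℚ-+ (+ a) (+ b)

ℕ→ℚ-* : ∀ a b → ℕ→ℚ (a * b) ≡ ℕ→ℚ a ℚ.* ℕ→ℚ b
ℕ→ℚ-* a b = trans (cong ℤ→ℚ (ℤ.pos-* a b)) (ℤ→ℚ-* (+ a) (+ b))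

recip : ℕ → ℚ
recip i = + 1 ℚ./ suc i

suc*recip : ∀ i → ℕ→ℚ (suc i) ℚ.* recip i ≡ 1ℚ
suc*recip i = ℚ.toℚᵘ-injective (ℚᵘ.≃-trans (ℚ.toℚᵘ-homo-* (ℕ→ℚ (suc i)) (recip i))
  (ℚᵘ.≃-trans (ℚᵘ.*-cong (ℚ.toℚᵘ-fromℚᵘ (mkℚᵘ (+ suc i) 0)) (ℚ.toℚᵘ-fromℚᵘ (mkℚᵘ (+ 1) i)))
  (*≡* (cong +_ (identity i)))))
  where
  identity : ∀ i → suc i * 1 * 1 ≡ 1 * suc (i + 0)
  identity = ℕ-Solver.solve-∀

suc*-cancel : ∀ i {x y} → ℕ→ℚ (suc i) ℚ.* x ≡ ℕ→ℚ (suc i) ℚ.* y → x ≡ y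
suc*-cancel i {x} {y} eq = trans (sym (undo x)) (trans (cong (recip i ℚ.*_) eq) (undo y))
  where
  undo : ∀ x → recip i ℚ.* (ℕ→ℚ (suc i) ℚ.* x) ≡ x
  undo x = begin
    recip i ℚ.* (ℕ→ℚ (suc i) ℚ.* x) ≡⟨ ℚ.*-assoc (recip i) _ x ⟨
    recip i ℚ.* ℕ→ℚ (suc i) ℚ.* x
      ≡⟨ cong (ℚ._* x) (trans (ℚ.*-comm (recip i) _) (suc*recip i)) ⟩
    1ℚ ℚ.* x ≡⟨ ℚ.*-identityˡ x ⟩
    x ∎

+-integer : ∀ {x y} → IsInteger x → IsInteger y → IsInteger (x ℚ.+ y)
+-integer (a , refl) (b , refl) = a ℤ.+ b , sym (ℤ→ℚ-+ a b)

*-integer : ∀ {x y} → IsInteger x → IsInteger y → IsInteger (x ℚ.* y)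
*-integer (a , refl) (b , refl) = a ℤ.* b , sym (ℤ→ℚ-* a b)

neg-integer : ∀ {x} → IsInteger x → IsInteger (ℚ.- x)
neg-integer {x} x∈ℤ = subst IsInteger
  (solve 1 (λ x → con (ℚ.- 1ℚ) :* x := :- x) refl x) (*-integer (ℤ.- + 1 , refl) x∈ℤ)

ℕ-integer : ∀ a → IsInteger (ℕ→ℚ a)
ℕ-integer a = + a , refl

integer-ratio⇒∣ : ∀ {i a x} → ℕ→ℚ (suc i) ℚ.* x ≡ ℕ→ℚ a → IsInteger x → suc i ∣ a
integer-ratio⇒∣ {i} {a} eq (z , refl) = divides ℤ.∣ z ∣ (begin
  a
    ≡⟨ cong ℤ.∣_∣ (ℤ→ℚ-injective {+ suc i ℤ.* z} {+ a} (trans (ℤ→ℚ-* (+ suc i) z) eq)) ⟨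
  ℤ.∣ + suc i ℤ.* z ∣ ≡⟨ ℤ.abs-* (+ suc i) z ⟩
  suc i * ℤ.∣ z ∣     ≡⟨ ℕ.*-comm (suc i) ℤ.∣ z ∣ ⟩
  ℤ.∣ z ∣ * suc i     ∎)

∣⇒integer-ratio : ∀ {i a x} → ℕ→ℚ (suc i) ℚ.* x ≡ ℕ→ℚ a → suc i ∣ a → IsInteger x
∣⇒integer-ratio {i} eq (divides b refl) =
  + b , suc*-cancel i (trans eq (trans (ℕ→ℚ-* b (suc i)) (ℚ.*-comm (ℕ→ℚ b) _)))

-- newton e z is the Newton series Σₖ e k · (z)ₖ, a finite sum at every natural number z.
newton : (ℕ → ℚ) → ℕ → ℚ
newton e zero    = e 0
newton e (suc z) = e 0 ℚ.+ ℕ→ℚ (suc z) ℚ.* newton (e ∘ suc) z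

newton-cong : ∀ {e f} → (∀ k → e k ≡ f k) → ∀ z → newton e z ≡ newton f z
newton-cong e≗f zero    = e≗f 0
newton-cong e≗f (suc z) =
  cong₂ (λ x y → x ℚ.+ ℕ→ℚ (suc z) ℚ.* y) (e≗f 0) (newton-cong (e≗f ∘ suc) z)

newton-0 : ∀ z → newton (λ _ → 0ℚ) z ≡ 0ℚ
newton-0 zero    = refl
newton-0 (suc z) = trans (ℚ.+-identityˡ _)
  (trans (cong (ℕ→ℚ (suc z) ℚ.*_) (newton-0 z)) (ℚ.*-zeroʳ (ℕ→ℚ (suc z))))

newton-+ : ∀ e f z → newton (λ k → e k ℚ.+ f k) z ≡ newton e z ℚ.+ newton f z
newton-+ e f zero    = refl
newton-+ e f (suc z) = trans
  (cong (λ x → (e 0 ℚ.+ f 0) ℚ.+ ℕ→ℚ (suc z) ℚ.* x) (newton-+ (e ∘ suc) (f ∘ suc) z))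
  (solve 5 (λ a b s x y → (a :+ b) :+ s :* (x :+ y) := (a :+ s :* x) :+ (b :+ s :* y)) refl
    (e 0) (f 0) (ℕ→ℚ (suc z)) (newton (e ∘ suc) z) (newton (f ∘ suc) z))

newton-injective : ∀ {e f} → (∀ z → newton e z ≡ newton f z) → ∀ k → e k ≡ f k
newton-injective eq zero = eq 0
newton-injective {e} {f} eq (suc k) = newton-injective (λ z → suc*-cancel z
  (ℚ+.∙-cancelˡ (e 0) _ _ (trans (eq (suc z)) (cong (ℚ._+ _) (sym (eq 0)))))) k

difference : (ℕ → ℚ) → ℕ → ℚ
difference e k = ℕ→ℚ (suc k) ℚ.* e (suc k)

-- Termwise this is (z + 1)ₖ₊₁ - (z)ₖ₊₁ = (k + 1)(z)ₖ.
newton-difference : ∀ e z → newton e (suc z) ≡ newton e z ℚ.+ newton (difference e) z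
newton-difference e zero    = refl
newton-difference e (suc z) = begin
  e 0 ℚ.+ ℕ→ℚ (suc (suc z)) ℚ.* X
    ≡⟨ cong (λ t → e 0 ℚ.+ t ℚ.* X) (ℕ→ℚ-+ 1 (suc z)) ⟩
  e 0 ℚ.+ (1ℚ ℚ.+ s) ℚ.* X
    ≡⟨ solve 3 (λ a s x → a :+ (con 1ℚ :+ s) :* x := a :+ s :* x :+ x) refl (e 0) s X ⟩
  (e 0 ℚ.+ s ℚ.* X) ℚ.+ X
    ≡⟨ cong (λ x → (e 0 ℚ.+ s ℚ.* x) ℚ.+ X) (newton-difference (e ∘ suc) z) ⟩
  (e 0 ℚ.+ s ℚ.* (A ℚ.+ B)) ℚ.+ (e 1 ℚ.+ s ℚ.* C)
    ≡⟨ solve 6 (λ a b s x y w → (a :+ s :* (x :+ y)) :+ (b :+ s :* w) :=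
         (a :+ s :* x) :+ (b :+ s :* (y :+ w))) refl (e 0) (e 1) s A B C ⟩
  (e 0 ℚ.+ s ℚ.* A) ℚ.+ (e 1 ℚ.+ s ℚ.* (B ℚ.+ C))
    ≡⟨ cong (λ x → (e 0 ℚ.+ s ℚ.* A) ℚ.+ x) (cong₂ (λ x y → x ℚ.+ s ℚ.* y)
         (sym (ℚ.*-identityˡ (e 1)))
         (trans (sym (newton-+ (difference (e ∘ suc)) (e ∘ suc ∘ suc) z)) (newton-cong shift z))) ⟩
  (e 0 ℚ.+ s ℚ.* A) ℚ.+ (difference e 0 ℚ.+ s ℚ.* newton (difference e ∘ suc) z) ∎
  where
  s = ℕ→ℚ (suc z)
  X = newton (e ∘ suc) (suc z)
  A = newton (e ∘ suc) z
  B = newton (difference (e ∘ suc)) z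
  C = newton (e ∘ suc ∘ suc) z
  shift : ∀ k → difference (e ∘ suc) k ℚ.+ e (2 + k) ≡ difference e (suc k)
  shift k = trans
    (solve 2 (λ t x → t :* x :+ x := (con 1ℚ :+ t) :* x) refl (ℕ→ℚ (suc k)) (e (2 + k)))
    (cong (ℚ._* e (2 + k)) (sym (ℕ→ℚ-+ 1 (suc k))))

-- Newton coefficients of b + (z + r) f(z), where e are those of f.
mulAdd : ℕ → ℚ → (ℕ → ℚ) → ℕ → ℚ
mulAdd r b e zero    = b ℚ.+ ℕ→ℚ r ℚ.* e 0
mulAdd r b e (suc k) = e k ℚ.+ ℕ→ℚ (r + suc k) ℚ.* e (suc k)

-- Termwise this is (z + r)(z)ₖ = (z)ₖ₊₁ + (r + k)(z)ₖ. In the induction on z, dropping the first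
-- coefficient replaces `r` by r + 1 and `b` by `e 0`.
newton-mulAdd : ∀ r b e z → newton (mulAdd r b e) z ≡ b ℚ.+ ℕ→ℚ (z + r) ℚ.* newton e z
newton-mulAdd r b e zero    = refl
newton-mulAdd r b e (suc z) = begin
  (b ℚ.+ ℕ→ℚ r ℚ.* e 0) ℚ.+ s ℚ.* newton (mulAdd r b e ∘ suc) z
    ≡⟨ cong (λ x → (b ℚ.+ ℕ→ℚ r ℚ.* e 0) ℚ.+ s ℚ.* x)
         (trans (newton-cong shift z) (newton-mulAdd (suc r) (e 0) (e ∘ suc) z)) ⟩
  (b ℚ.+ ℕ→ℚ r ℚ.* e 0) ℚ.+ s ℚ.* (e 0 ℚ.+ ℕ→ℚ (z + suc r) ℚ.* X)
    ≡⟨ cong (λ t → (b ℚ.+ ℕ→ℚ r ℚ.* e 0) ℚ.+ s ℚ.* (e 0 ℚ.+ t ℚ.* X))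
         (trans (cong ℕ→ℚ (ℕ.+-suc z r)) (ℕ→ℚ-+ (suc z) r)) ⟩
  (b ℚ.+ ℕ→ℚ r ℚ.* e 0) ℚ.+ s ℚ.* (e 0 ℚ.+ (s ℚ.+ ℕ→ℚ r) ℚ.* X)
    ≡⟨ solve 5 (λ b r a s x → (b :+ r :* a) :+ s :* (a :+ (s :+ r) :* x) :=
         b :+ (s :+ r) :* (a :+ s :* x)) refl b (ℕ→ℚ r) (e 0) s X ⟩
  b ℚ.+ (s ℚ.+ ℕ→ℚ r) ℚ.* (e 0 ℚ.+ s ℚ.* X)
    ≡⟨ cong (λ t → b ℚ.+ t ℚ.* (e 0 ℚ.+ s ℚ.* X)) (ℕ→ℚ-+ (suc z) r) ⟨
  b ℚ.+ ℕ→ℚ (suc z + r) ℚ.* newton e (suc z) ∎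
  where
  s = ℕ→ℚ (suc z)
  X = newton (e ∘ suc) z
  shift : ∀ k → mulAdd r b e (suc k) ≡ mulAdd (suc r) (e 0) (e ∘ suc) k
  shift zero    = cong (λ t → e 0 ℚ.+ ℕ→ℚ t ℚ.* e 1) (ℕ.+-comm r 1)
  shift (suc k) = cong (λ t → e (suc k) ℚ.+ ℕ→ℚ t ℚ.* e (2 + k)) (ℕ.+-suc r (suc k))

newton-stirling : ∀ r n z → newton (ℕ→ℚ ∘ stirling r n) z ≡ ℕ→ℚ ((z + r) ^ n)
newton-stirling r zero    zero    = refl
newton-stirling r zero    (suc z) = trans
  (cong (λ x → 1ℚ ℚ.+ ℕ→ℚ (suc z) ℚ.* x) (newton-0 z))
  (trans (cong (1ℚ ℚ.+_) (ℚ.*-zeroʳ (ℕ→ℚ (suc z)))) (ℚ.+-identityʳ 1ℚ))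
newton-stirling r (suc n) z       = begin
  newton (ℕ→ℚ ∘ stirling r (suc n)) z                  ≡⟨ newton-cong step z ⟩
  newton (mulAdd r 0ℚ (ℕ→ℚ ∘ stirling r n)) z          ≡⟨ newton-mulAdd r 0ℚ _ z ⟩
  0ℚ ℚ.+ ℕ→ℚ (z + r) ℚ.* newton (ℕ→ℚ ∘ stirling r n) z ≡⟨ ℚ.+-identityˡ _ ⟩
  ℕ→ℚ (z + r) ℚ.* newton (ℕ→ℚ ∘ stirling r n) z
    ≡⟨ cong (ℕ→ℚ (z + r) ℚ.*_) (newton-stirling r n z) ⟩
  ℕ→ℚ (z + r) ℚ.* ℕ→ℚ ((z + r) ^ n)                    ≡⟨ ℕ→ℚ-* (z + r) ((z + r) ^ n) ⟨
  ℕ→ℚ ((z + r) ^ suc n)                                ∎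
  where
  step : ∀ k → ℕ→ℚ (stirling r (suc n) k) ≡ mulAdd r 0ℚ (ℕ→ℚ ∘ stirling r n) k
  step zero    = trans (ℕ→ℚ-* r (stirling r n 0)) (sym (ℚ.+-identityˡ _))
  step (suc k) = trans (ℕ→ℚ-+ (stirling r n k) _)
    (cong (ℕ→ℚ (stirling r n k) ℚ.+_) (ℕ→ℚ-* (r + suc k) (stirling r n (suc k))))

-- Newton coefficients at the nodes 1, 2, 3, … of a polynomial given by its coefficients.
toNewton : ∀ {m} → Vec ℚ m → ℕ → ℚ
toNewton []      = λ _ → 0ℚ
toNewton (a ∷ c) = mulAdd 1 a (toNewton c)

newton-toNewton : ∀ {m} (c : Vec ℚ m) z → newton (toNewton c) z ≡ evalPoly c (ℕ→ℚ (suc z))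
newton-toNewton []      z = newton-0 z
newton-toNewton (a ∷ c) z = trans (newton-mulAdd 1 a (toNewton c) z)
  (cong₂ (λ t x → a ℚ.+ ℕ→ℚ t ℚ.* x) (ℕ.+-comm z 1) (newton-toNewton c z))

toNewton-above : ∀ {m} (c : Vec ℚ m) {k} → m ≤ k → toNewton c k ≡ 0ℚ
toNewton-above []      _ = refl
toNewton-above (a ∷ c) {suc k} (s≤s m≤k) = trans
  (cong₂ (λ x y → x ℚ.+ ℕ→ℚ (1 + suc k) ℚ.* y)
    (toNewton-above c m≤k) (toNewton-above c (ℕ.m≤n⇒m≤1+n m≤k)))
  (trans (ℚ.+-identityˡ _) (ℚ.*-zeroʳ (ℕ→ℚ (1 + suc k))))

-- Change of basis and integrality

module _ (d : ℕ) where

  private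
    Cleared : ℚ → Set
    Cleared x = IsInteger (ℕ→ℚ d ℚ.* x)

    cleared-0 : ∀ {x} → x ≡ 0ℚ → Cleared x
    cleared-0 refl = + 0 , ℚ.*-zeroʳ (ℕ→ℚ d)

    cleared-mulAdd : ∀ r {x y} → Cleared x → Cleared y → Cleared (x ℚ.+ ℕ→ℚ r ℚ.* y)
    cleared-mulAdd r {x} {y} dx dy = subst IsInteger
      (solve 4 (λ d r x y → d :* x :+ r :* (d :* y) := d :* (x :+ r :* y)) refl (ℕ→ℚ d) (ℕ→ℚ r) x y)
      (+-integer dx (*-integer (ℕ-integer r) dy))

    cleared-mulAdd⁻¹ : ∀ r {x y} → Cleared (x ℚ.+ ℕ→ℚ r ℚ.* y) → Cleared y → Cleared x
    cleared-mulAdd⁻¹ r {x} {y} dxy dy = subst IsInteger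
      (solve 4 (λ d r x y → d :* (x :+ r :* y) :+ :- (r :* (d :* y)) := d :* x) refl
        (ℕ→ℚ d) (ℕ→ℚ r) x y)
      (+-integer dxy (neg-integer (*-integer (ℕ-integer r) dy)))

  clears⇒toNewton : ∀ {m} {c : Vec ℚ m} → ClearsDenominators c d → ∀ k → Cleared (toNewton c k)
  clears⇒toNewton []        k       = cleared-0 refl
  clears⇒toNewton (da ∷ dc) zero    = cleared-mulAdd 1 da (clears⇒toNewton dc 0)
  clears⇒toNewton (da ∷ dc) (suc k) =
    cleared-mulAdd (1 + suc k) (clears⇒toNewton dc k) (clears⇒toNewton dc (suc k))

  -- The change of basis is unitriangular over ℤ, so it can be undone without denominators.
  toNewton⇒clears : ∀ {m} (c : Vec ℚ m) → (∀ k → Cleared (toNewton c k)) → ClearsDenominators c d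
  toNewton⇒clears         []      _   = []
  toNewton⇒clears {suc m} (a ∷ c) int =
    cleared-mulAdd⁻¹ 1 (int 0) (tail 0) ∷ toNewton⇒clears c tail
    where
    -- Downward induction on k: from index m on the coefficients vanish, and each lower one is found
    -- from the next by subtracting an integer multiple of it. The distance to m is at most `j`.
    tailFrom : ∀ j k → m ≤ j + k → Cleared (toNewton c k)
    tailFrom zero    k m≤k = cleared-0 (toNewton-above c m≤k)
    tailFrom (suc j) k m≤  = cleared-mulAdd⁻¹ (1 + suc k) (int (suc k))
      (tailFrom j (suc k) (ℕ.≤-trans m≤ (ℕ.≤-reflexive (sym (ℕ.+-suc j k)))))
    tail : ∀ k → Cleared (toNewton c k)
    tail k = tailFrom m k (ℕ.m≤m+n m k)

*stirling-shift : ∀ d r n k →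
  d * stirling (suc r) n k ≡ suc k * (d * stirling r n (suc k)) + d * stirling r n k
*stirling-shift d r n k = trans (cong (d *_) (stirling-shift r n k))
  (identity d (suc k) (stirling r n k) (stirling r n (suc k)))
  where
  identity : ∀ d k s t → d * (s + k * t) ≡ k * (d * t) + d * s
  identity = ℕ-Solver.solve-∀

suc∣stirling-shift⇒ : ∀ d r n k → suc k ∣ d * stirling (suc r) n k → suc k ∣ d * stirling r n k
suc∣stirling-shift⇒ d r n k div = ∣m+n∣m⇒∣n
  (subst (suc k ∣_) (*stirling-shift d r n k) div) (m∣m*n (d * stirling r n (suc k)))

suc∣stirling-shift⇐ : ∀ d r n k → suc k ∣ d * stirling r n k → suc k ∣ d * stirling (suc r) n k
suc∣stirling-shift⇐ d r n k div = subst (suc k ∣_) (sym (*stirling-shift d r n k))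
  (∣m∣n⇒∣m+n (m∣m*n (d * stirling r n (suc k))) div)

module _ (n : ℕ) {m} (c : Vec ℚ m)
  (interpolates : ∀ x → evalPoly c (ℕ→ℚ (suc x)) ≡ ℕ→ℚ (powerSum n (suc x))) where

  private
    newton-powerSum : ∀ z → newton (toNewton c) z ≡ ℕ→ℚ (powerSum n (suc z))
    newton-powerSum z = trans (newton-toNewton c z) (interpolates z)

    -- The nodes start at 1, so the step from z to z + 1 adds (z + 2)ⁿ to the power sum; hence the
    -- parameter 2.
    difference-toNewton : ∀ k → difference (toNewton c) k ≡ ℕ→ℚ (stirling 2 n k)
    difference-toNewton = newton-injective λ z → ℚ+.∙-cancelˡ (newton (toNewton c) z) _ _ (begin
      newton (toNewton c) z ℚ.+ newton (difference (toNewton c)) z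
        ≡⟨ newton-difference (toNewton c) z ⟨
      newton (toNewton c) (suc z)                       ≡⟨ newton-powerSum (suc z) ⟩
      ℕ→ℚ (powerSum n (suc z) + suc (suc z) ^ n)        ≡⟨ ℕ→ℚ-+ (powerSum n (suc z)) _ ⟩
      ℕ→ℚ (powerSum n (suc z)) ℚ.+ ℕ→ℚ (suc (suc z) ^ n)
        ≡⟨ cong₂ ℚ._+_ (newton-powerSum z)
             (trans (newton-stirling 2 n z) (cong (λ t → ℕ→ℚ (t ^ n)) (ℕ.+-comm z 2))) ⟨
      newton (toNewton c) z ℚ.+ newton (ℕ→ℚ ∘ stirling 2 n) z ∎)

    scaled : ∀ d k → ℕ→ℚ (suc k) ℚ.* (ℕ→ℚ d ℚ.* toNewton c (suc k)) ≡ ℕ→ℚ (d * stirling 2 n k)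
    scaled d k = begin
      ℕ→ℚ (suc k) ℚ.* (ℕ→ℚ d ℚ.* toNewton c (suc k))
        ≡⟨ solve 3 (λ k d x → k :* (d :* x) := d :* (k :* x)) refl
             (ℕ→ℚ (suc k)) (ℕ→ℚ d) (toNewton c (suc k)) ⟩
      ℕ→ℚ d ℚ.* difference (toNewton c) k ≡⟨ cong (ℕ→ℚ d ℚ.*_) (difference-toNewton k) ⟩
      ℕ→ℚ d ℚ.* ℕ→ℚ (stirling 2 n k)      ≡⟨ ℕ→ℚ-* d (stirling 2 n k) ⟨
      ℕ→ℚ (d * stirling 2 n k)            ∎

  -- The Newton coefficient of index k + 1 is `stirling 2 n k` divided by k + 1, and modulo k + 1
  -- two shifts replace the parameter 2 by 0.
  clears⇒suc∣stirling : ∀ {d} → ClearsDenominators c d → ∀ k → suc k ∣ d * S n k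
  clears⇒suc∣stirling {d} clears k = suc∣stirling-shift⇒ d 0 n k (suc∣stirling-shift⇒ d 1 n k
    (integer-ratio⇒∣ (scaled d k) (clears⇒toNewton d clears (suc k))))

  suc∣stirling⇒clears : ∀ {d} → (∀ k → suc k ∣ d * S n k) → ClearsDenominators c d
  suc∣stirling⇒clears {d} div = toNewton⇒clears d c λ where
    -- The coefficient of index 0 is the power sum at the first node, already an integer.
    zero    → *-integer (ℕ-integer d) (+ powerSum n 1 , newton-powerSum 0)
    (suc k) → ∣⇒integer-ratio (scaled d k)
      (suc∣stirling-shift⇐ d 1 n k (suc∣stirling-shift⇐ d 0 n k (div k)))

-- The logarithmic expansion of (n + 1) S(n,k)/(k + 1)

alternatingSum : (ℕ → ℚ) → ℕ → ℚ
alternatingSum f zero    = 0ℚ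
alternatingSum f (suc N) = f 0 ℚ.- alternatingSum (f ∘ suc) N

alternatingSum-cong : ∀ {f g} → (∀ i → f i ≡ g i) → ∀ N → alternatingSum f N ≡ alternatingSum g N
alternatingSum-cong f≗g zero    = refl
alternatingSum-cong f≗g (suc N) = cong₂ ℚ._-_ (f≗g 0) (alternatingSum-cong (f≗g ∘ suc) N)

alternatingSum-+ : ∀ f g N → alternatingSum (λ i → f i ℚ.+ g i) N ≡
  alternatingSum f N ℚ.+ alternatingSum g N
alternatingSum-+ f g zero    = refl
alternatingSum-+ f g (suc N) = trans
  (cong (ℚ._-_ (f 0 ℚ.+ g 0)) (alternatingSum-+ (f ∘ suc) (g ∘ suc) N))
  (solve 4 (λ a b x y → (a :+ b) :- (x :+ y) := (a :- x) :+ (b :- y)) refl (f 0) (g 0) _ _)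

alternatingSum-* : ∀ w f N → alternatingSum (λ i → w ℚ.* f i) N ≡ w ℚ.* alternatingSum f N
alternatingSum-* w f zero    = sym (ℚ.*-zeroʳ w)
alternatingSum-* w f (suc N) = trans
  (cong (ℚ._-_ (w ℚ.* f 0)) (alternatingSum-* w (f ∘ suc) N))
  (solve 3 (λ w a x → w :* a :- w :* x := w :* (a :- x)) refl w (f 0) _)

alternatingSum-telescope : ∀ f N → f N ≡ 0ℚ → alternatingSum (λ i → f i ℚ.+ f (suc i)) N ≡ f 0
alternatingSum-telescope f zero    eq = sym eq
alternatingSum-telescope f (suc N) eq = trans
  (cong (ℚ._-_ (f 0 ℚ.+ f 1)) (alternatingSum-telescope (f ∘ suc) N eq))
  (solve 2 (λ a b → (a :+ b) :- b := a) refl (f 0) (f 1))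

-- The coefficient of zⁿ/n! in (eᶻ - 1)ᵏ.
surjections : ℕ → ℕ → ℕ
surjections n k = k ! * S n k

-- The derivative of (eᶻ - 1)ᵏ⁺¹ is (k + 1)((eᶻ - 1)ᵏ + (eᶻ - 1)ᵏ⁺¹).
surjections-suc : ∀ n k →
  surjections (suc n) (suc k) ≡ suc k * (surjections n k + surjections n (suc k))
surjections-suc n k = identity (suc k) (k !) (S n k) (S n (suc k))
  where
  identity : ∀ k f s t → (k * f) * (s + k * t) ≡ k * (f * s + (k * f) * t)
  identity = ℕ-Solver.solve-∀

surjections-above : ∀ {n k} → n < k → surjections n k ≡ 0
surjections-above {n} {k} n<k = trans (cong (k ! *_) (stirling-above 0 n<k)) (ℕ.*-zeroʳ (k !))

-- The coefficient of zⁿ/n! in z (eᶻ - 1)ᵏ; the clauses avoid truncated subtraction.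
n*surjections[n-1] : ℕ → ℕ → ℕ
n*surjections[n-1] zero    k = 0
n*surjections[n-1] (suc n) k = suc n * surjections n k

n*surjections-zero : ∀ n → surjections n 0 ≡ n*surjections[n-1] (suc n) 0
n*surjections-zero zero    = refl
n*surjections-zero (suc n) = sym (ℕ.*-zeroʳ (suc (suc n)))

n*surjections-suc : ∀ n k →
  surjections n (suc k) + suc k * (n*surjections[n-1] n k + n*surjections[n-1] n (suc k)) ≡
  n*surjections[n-1] (suc n) (suc k)
n*surjections-suc zero    k = cong (λ t → surjections 0 (suc k) + t) (ℕ.*-zeroʳ (suc k))
n*surjections-suc (suc n) k = trans
  (cong (λ t → surjections (suc n) (suc k) + t)
    (identity (suc k) (suc n) (surjections n k) (surjections n (suc k))))
  (cong (λ t → surjections (suc n) (suc k) + suc n * t) (sym (surjections-suc n k)))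
  where
  identity : ∀ k n s t → k * (n * s + n * t) ≡ n * (k * (s + t))
  identity = ℕ-Solver.solve-∀

-- z (eᶻ − 1)ᵏ = Σᵢ (−1)ⁱ (eᶻ − 1)ᵏ⁺¹⁺ⁱ / (i + 1), because z = log (1 + (eᶻ − 1)); these are the
-- coefficients of zⁿ/n!.
surjections-log : ∀ n k N → n ≤ N →
  alternatingSum (λ i → recip i ℚ.* ℕ→ℚ (surjections n (suc (k + i)))) N ≡
  ℕ→ℚ (n*surjections[n-1] n k)
surjections-log zero    k N _     = trans
  (alternatingSum-cong (λ i → trans
    (cong (λ t → recip i ℚ.* ℕ→ℚ t) (surjections-above {0} {suc (k + i)} (s≤s z≤n)))
    (trans (ℚ.*-zeroʳ (recip i)) (sym (ℚ.*-zeroˡ 0ℚ)))) N)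
  (trans (alternatingSum-* 0ℚ (λ _ → 0ℚ) N) (ℚ.*-zeroˡ (alternatingSum (λ _ → 0ℚ) N)))
surjections-log (suc n) k N n<N = begin
  alternatingSum (λ i → recip i ℚ.* ℕ→ℚ (surjections (suc n) (suc (k + i)))) N
    ≡⟨ alternatingSum-cong expand N ⟩
  alternatingSum (λ i → (f i ℚ.+ f (suc i)) ℚ.+ ℕ→ℚ k ℚ.* (g i ℚ.+ g′ i)) N
    ≡⟨ alternatingSum-+ _ _ N ⟩
  alternatingSum (λ i → f i ℚ.+ f (suc i)) N ℚ.+
    alternatingSum (λ i → ℕ→ℚ k ℚ.* (g i ℚ.+ g′ i)) N
    ≡⟨ cong₂ ℚ._+_ (alternatingSum-telescope f N
         (cong ℕ→ℚ (surjections-above (ℕ.≤-trans n<N (ℕ.m≤n+m N k)))))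
         (trans (alternatingSum-* (ℕ→ℚ k) _ N) (cong (ℕ→ℚ k ℚ.*_) (alternatingSum-+ g g′ N))) ⟩
  f 0 ℚ.+ ℕ→ℚ k ℚ.* (alternatingSum g N ℚ.+ alternatingSum g′ N)
    ≡⟨ cong₂ (λ t y → ℕ→ℚ (surjections n t) ℚ.+ ℕ→ℚ k ℚ.* (alternatingSum g N ℚ.+ y))
         (ℕ.+-identityʳ k) (surjections-log n k N n≤N) ⟩
  ℕ→ℚ (surjections n k) ℚ.+
    ℕ→ℚ k ℚ.* (alternatingSum g N ℚ.+ ℕ→ℚ (n*surjections[n-1] n k))
    ≡⟨ collect k ⟩
  ℕ→ℚ (n*surjections[n-1] (suc n) k) ∎
  where
  n≤N = ℕ.<⇒≤ n<N
  f g g′ : ℕ → ℚ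
  f i  = ℕ→ℚ (surjections n (k + i))
  g i  = recip i ℚ.* ℕ→ℚ (surjections n (k + i))
  g′ i = recip i ℚ.* ℕ→ℚ (surjections n (suc (k + i)))
  -- The expansion is differentiated term by term. In k + 1 + i = (i + 1) + k the part i + 1 cancels
  -- the denominator and leaves a telescoping sum; the part k leads back to n.
  expand : ∀ i → recip i ℚ.* ℕ→ℚ (surjections (suc n) (suc (k + i))) ≡
    (f i ℚ.+ f (suc i)) ℚ.+ ℕ→ℚ k ℚ.* (g i ℚ.+ g′ i)
  expand i = begin
    recip i ℚ.* ℕ→ℚ (surjections (suc n) (suc (k + i)))
      ≡⟨ cong (λ t → recip i ℚ.* ℕ→ℚ t) (trans (surjections-suc n (k + i))
           (cong (_* (a + b)) (sym (ℕ.+-suc k i)))) ⟩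
    recip i ℚ.* ℕ→ℚ ((k + suc i) * (a + b))
      ≡⟨ cong (recip i ℚ.*_) (trans (ℕ→ℚ-* (k + suc i) (a + b))
           (cong₂ ℚ._*_ (ℕ→ℚ-+ k (suc i)) (ℕ→ℚ-+ a b))) ⟩
    recip i ℚ.* ((ℕ→ℚ k ℚ.+ ℕ→ℚ (suc i)) ℚ.* (ℕ→ℚ a ℚ.+ ℕ→ℚ b))
      ≡⟨ solve 5 (λ r k s a b → r :* ((k :+ s) :* (a :+ b)) :=
           (s :* r) :* (a :+ b) :+ k :* (r :* a :+ r :* b)) refl
           (recip i) (ℕ→ℚ k) (ℕ→ℚ (suc i)) (ℕ→ℚ a) (ℕ→ℚ b) ⟩
    ℕ→ℚ (suc i) ℚ.* recip i ℚ.* (ℕ→ℚ a ℚ.+ ℕ→ℚ b) ℚ.+ ℕ→ℚ k ℚ.* (g i ℚ.+ g′ i)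
      ≡⟨ cong (ℚ._+ ℕ→ℚ k ℚ.* (g i ℚ.+ g′ i)) (trans (cong (ℚ._* (ℕ→ℚ a ℚ.+ ℕ→ℚ b)) (suc*recip i))
           (ℚ.*-identityˡ (ℕ→ℚ a ℚ.+ ℕ→ℚ b))) ⟩
    (ℕ→ℚ a ℚ.+ ℕ→ℚ b) ℚ.+ ℕ→ℚ k ℚ.* (g i ℚ.+ g′ i)
      ≡⟨ cong (λ t → (ℕ→ℚ a ℚ.+ ℕ→ℚ (surjections n t)) ℚ.+ ℕ→ℚ k ℚ.* (g i ℚ.+ g′ i)) (ℕ.+-suc k i) ⟨
    (f i ℚ.+ f (suc i)) ℚ.+ ℕ→ℚ k ℚ.* (g i ℚ.+ g′ i) ∎
    where
    a = surjections n (k + i)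
    b = surjections n (suc (k + i))
  -- For k = 0 the factor k removes the remaining sum; for k ≥ 1 this sum is the expansion for k -
  -- 1.
  collect : ∀ k → ℕ→ℚ (surjections n k) ℚ.+ ℕ→ℚ k ℚ.*
      (alternatingSum (λ i → recip i ℚ.* ℕ→ℚ (surjections n (k + i))) N ℚ.+
       ℕ→ℚ (n*surjections[n-1] n k)) ≡
    ℕ→ℚ (n*surjections[n-1] (suc n) k)
  collect zero    = trans (cong (ℕ→ℚ (surjections n 0) ℚ.+_)
      (ℚ.*-zeroˡ (alternatingSum g₀ N ℚ.+ ℕ→ℚ (n*surjections[n-1] n 0))))
    (trans (ℚ.+-identityʳ (ℕ→ℚ (surjections n 0))) (cong ℕ→ℚ (n*surjections-zero n)))
    where
    g₀ : ℕ → ℚ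
    g₀ i = recip i ℚ.* ℕ→ℚ (surjections n i)
  collect (suc k) = begin
    ℕ→ℚ (surjections n (suc k)) ℚ.+ ℕ→ℚ (suc k) ℚ.*
      (alternatingSum (λ i → recip i ℚ.* ℕ→ℚ (surjections n (suc k + i))) N ℚ.+ ℕ→ℚ b)
      ≡⟨ cong (λ x → ℕ→ℚ (surjections n (suc k)) ℚ.+ ℕ→ℚ (suc k) ℚ.* (x ℚ.+ ℕ→ℚ b))
           (surjections-log n k N n≤N) ⟩
    ℕ→ℚ (surjections n (suc k)) ℚ.+ ℕ→ℚ (suc k) ℚ.* (ℕ→ℚ a ℚ.+ ℕ→ℚ b)
      ≡⟨ cong (ℕ→ℚ (surjections n (suc k)) ℚ.+_)
           (trans (cong (ℕ→ℚ (suc k) ℚ.*_) (sym (ℕ→ℚ-+ a b))) (sym (ℕ→ℚ-* (suc k) (a + b)))) ⟩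
    ℕ→ℚ (surjections n (suc k)) ℚ.+ ℕ→ℚ (suc k * (a + b))
      ≡⟨ ℕ→ℚ-+ (surjections n (suc k)) _ ⟨
    ℕ→ℚ (surjections n (suc k) + suc k * (a + b)) ≡⟨ cong ℕ→ℚ (n*surjections-suc n k) ⟩
    ℕ→ℚ (n*surjections[n-1] (suc n) (suc k)) ∎
    where
    a = n*surjections[n-1] n k
    b = n*surjections[n-1] n (suc k)

nC*! : ∀ j i → ((j + i) C i) * (i ! * j !) ≡ (j + i) !
nC*! j i = begin
  ((j + i) C i) * (i ! * j !)
    ≡⟨ cong (λ t → ((j + i) C i) * (i ! * t !)) (ℕ.m+n∸n≡m j i) ⟨
  ((j + i) C i) * (i ! * (j + i ∸ i) !)
    ≡⟨ cong (_* (i ! * (j + i ∸ i) !)) (nCk≡n!/k![n-k]! i≤) ⟩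
  _ ≡⟨ m/n*n≡m (k![n∸k]!∣n! i≤) ⟩
  (j + i) ! ∎
  where
  i≤ = ℕ.m≤n+m i j
  instance
    nz : NonZero (i ! * (j + i ∸ i) !)
    nz = ℕ._!*_!≢0 i (j + i ∸ i)

!*-cancel : ∀ k {x y} → ℕ→ℚ (k !) ℚ.* x ≡ ℕ→ℚ (k !) ℚ.* y → x ≡ y
!*-cancel k eq with k ! | ℕ._!≢0 k
... | suc f | _ = suc*-cancel f eq

-- Divided by i + 1 this is, up to sign, the term of index i in the expansion of (n + 1) S(n,k)/(k +
-- 1).
numerator : ℕ → ℕ → ℕ → ℕ
numerator n k i = ((suc k + i) C i) * (i ! * S (suc n) (suc (k + i)))

-- This is `surjections-log` for n + 1 divided by k!, as (k + 1)! · i! · C(k + 1 + i, i) = (k + 1 +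
-- i)!. With 2 + n summands the terms i = 0 and i = 1 split off by computation.
stirling-log : ∀ n k →
  ℕ→ℚ (suc k) ℚ.* alternatingSum (λ i → recip i ℚ.* ℕ→ℚ (numerator n k i)) (2 + n) ≡
  ℕ→ℚ (suc n * S n k)
stirling-log n k = !*-cancel k (begin
  ℕ→ℚ (k !) ℚ.* (ℕ→ℚ (suc k) ℚ.* A)
    ≡⟨ solve 3 (λ f s a → f :* (s :* a) := (s :* f) :* a) refl (ℕ→ℚ (k !)) (ℕ→ℚ (suc k)) A ⟩
  ℕ→ℚ (suc k) ℚ.* ℕ→ℚ (k !) ℚ.* A
    ≡⟨ cong (ℚ._* A) (ℕ→ℚ-* (suc k) (k !)) ⟨
  ℕ→ℚ (suc k !) ℚ.* A
    ≡⟨ alternatingSum-* (ℕ→ℚ (suc k !)) summand (2 + n) ⟨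
  alternatingSum (λ i → ℕ→ℚ (suc k !) ℚ.* (recip i ℚ.* ℕ→ℚ (numerator n k i))) (2 + n)
    ≡⟨ alternatingSum-cong term (2 + n) ⟩
  alternatingSum (λ i → recip i ℚ.* ℕ→ℚ (surjections (suc n) (suc (k + i)))) (2 + n)
    ≡⟨ surjections-log (suc n) k (2 + n) (ℕ.n≤1+n (suc n)) ⟩
  ℕ→ℚ (suc n * (k ! * S n k))
    ≡⟨ cong ℕ→ℚ (identity (suc n) (k !) (S n k)) ⟩
  ℕ→ℚ (k ! * (suc n * S n k))
    ≡⟨ ℕ→ℚ-* (k !) (suc n * S n k) ⟩
  ℕ→ℚ (k !) ℚ.* ℕ→ℚ (suc n * S n k) ∎)
  where
  summand : ℕ → ℚ
  summand i = recip i ℚ.* ℕ→ℚ (numerator n k i)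
  A = alternatingSum summand (2 + n)
  identity : ∀ n f s → n * (f * s) ≡ f * (n * s)
  identity = ℕ-Solver.solve-∀
  regroup : ∀ c f g s → g * (c * (f * s)) ≡ (c * (f * g)) * s
  regroup = ℕ-Solver.solve-∀
  term : ∀ i → ℕ→ℚ (suc k !) ℚ.* (recip i ℚ.* ℕ→ℚ (numerator n k i)) ≡
    recip i ℚ.* ℕ→ℚ (surjections (suc n) (suc (k + i)))
  term i = begin
    ℕ→ℚ (suc k !) ℚ.* (recip i ℚ.* ℕ→ℚ (numerator n k i))
      ≡⟨ solve 3 (λ f r y → f :* (r :* y) := r :* (f :* y)) refl (ℕ→ℚ (suc k !)) (recip i) _ ⟩
    recip i ℚ.* (ℕ→ℚ (suc k !) ℚ.* ℕ→ℚ (numerator n k i))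
      ≡⟨ cong (recip i ℚ.*_) (ℕ→ℚ-* (suc k !) (numerator n k i)) ⟨
    recip i ℚ.* ℕ→ℚ (suc k ! * numerator n k i)
      ≡⟨ cong (λ t → recip i ℚ.* ℕ→ℚ t) (trans
           (regroup ((suc k + i) C i) (i !) (suc k !) (S (suc n) (suc (k + i))))
           (cong (_* S (suc n) (suc (k + i))) (nC*! (suc k) i))) ⟩
    recip i ℚ.* ℕ→ℚ (surjections (suc n) (suc (k + i))) ∎

-- For prime p this is divisibility in the localisation of ℤ at p, where `u` is a unit. `Integral`
-- is membership of a rational number in that ring.
_∣[_]_ : ℕ → ℕ → ℕ → Set
a ∣[ p ] b = ∃ λ u → ¬ p ∣ u × a ∣ u * b

Integral : ℕ → ℚ → Set
Integral p x = ∃ λ u → ¬ p ∣ u × IsInteger (ℕ→ℚ u ℚ.* x)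

module _ {p : ℕ} (p-prime : Prime p) where

  ∤-* : ∀ {a b} → ¬ p ∣ a → ¬ p ∣ b → ¬ p ∣ a * b
  ∤-* {a} {b} p∤a p∤b p∣ab = [ p∤a , p∤b ]′ (euclidsLemma a b p-prime p∣ab)

  ∤1 : ¬ p ∣ 1
  ∤1 p∣1 = ¬prime[1] (subst Prime (∣1⇒≡1 p∣1) p-prime)

  integral-0 : Integral p 0ℚ
  integral-0 = 1 , ∤1 , + 0 , refl

  integral-- : ∀ {x y} → Integral p x → Integral p y → Integral p (x ℚ.- y)
  integral-- {x} {y} (u , p∤u , ux) (v , p∤v , vy) = u * v , ∤-* p∤u p∤v ,
    subst IsInteger (trans
      (solve 4 (λ u v x y → v :* (u :* x) :+ :- (u :* (v :* y)) := (u :* v) :* (x :- y)) refl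
        (ℕ→ℚ u) (ℕ→ℚ v) x y) (cong (ℚ._* (x ℚ.- y)) (sym (ℕ→ℚ-* u v))))
      (+-integer (*-integer (ℕ-integer v) ux) (neg-integer (*-integer (ℕ-integer u) vy)))

  integral-alternatingSum : ∀ f N → (∀ i → Integral p (f i)) → Integral p (alternatingSum f N)
  integral-alternatingSum f zero    _   = integral-0
  integral-alternatingSum f (suc N) int =
    integral-- (int 0) (integral-alternatingSum (f ∘ suc) N (int ∘ suc))

integral⇒∣ : ∀ {p i a x} → ℕ→ℚ (suc i) ℚ.* x ≡ ℕ→ℚ a → Integral p x → suc i ∣[ p ] a
integral⇒∣ {_} {i} {a} {x} eq (u , p∤u , ux) = u , p∤u , integer-ratio⇒∣ (trans
  (solve 3 (λ s u x → s :* (u :* x) := u :* (s :* x)) refl (ℕ→ℚ (suc i)) (ℕ→ℚ u) x)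
  (trans (cong (ℕ→ℚ u ℚ.*_) eq) (sym (ℕ→ℚ-* u a)))) ux

∣⇒integral : ∀ {p i a x} → ℕ→ℚ (suc i) ℚ.* x ≡ ℕ→ℚ a → suc i ∣[ p ] a → Integral p x
∣⇒integral {_} {i} {a} {x} eq (u , p∤u , div) = u , p∤u , ∣⇒integer-ratio (trans
  (solve 3 (λ s u x → s :* (u :* x) := u :* (s :* x)) refl (ℕ→ℚ (suc i)) (ℕ→ℚ u) x)
  (trans (cong (ℕ→ℚ u ℚ.*_) eq) (sym (ℕ→ℚ-* u a)))) div

suc*recip* : ∀ i x → ℕ→ℚ (suc i) ℚ.* (recip i ℚ.* x) ≡ x
suc*recip* i x = trans (sym (ℚ.*-assoc (ℕ→ℚ (suc i)) (recip i) x))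
  (trans (cong (ℚ._* x) (suc*recip i)) (ℚ.*-identityˡ x))

-- The sum is p-integral when every summand is. The weight `w` is p for squarefreeness and 1
-- otherwise.
stirling-local : ∀ {p} → Prime p → ∀ w n k → (∀ i → suc i ∣[ p ] (w * numerator n k i)) →
  suc k ∣[ p ] (w * (suc n * S n k))
stirling-local {p} p-prime w n k div = integral⇒∣ total
  (integral-alternatingSum p-prime _ (2 + n) λ i → ∣⇒integral (term i) (div i))
  where
  summand : ℕ → ℚ
  summand i = recip i ℚ.* ℕ→ℚ (numerator n k i)
  term : ∀ i → ℕ→ℚ (suc i) ℚ.* (ℕ→ℚ w ℚ.* summand i) ≡ ℕ→ℚ (w * numerator n k i)
  term i = trans
    (solve 3 (λ s w x → s :* (w :* x) := w :* (s :* x)) refl (ℕ→ℚ (suc i)) (ℕ→ℚ w) (summand i))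
    (trans (cong (ℕ→ℚ w ℚ.*_) (suc*recip* i _)) (sym (ℕ→ℚ-* w (numerator n k i))))
  total : ℕ→ℚ (suc k) ℚ.* alternatingSum (λ i → ℕ→ℚ w ℚ.* summand i) (2 + n) ≡
    ℕ→ℚ (w * (suc n * S n k))
  total = begin
    ℕ→ℚ (suc k) ℚ.* alternatingSum (λ i → ℕ→ℚ w ℚ.* summand i) (2 + n)
      ≡⟨ cong (ℕ→ℚ (suc k) ℚ.*_) (alternatingSum-* (ℕ→ℚ w) summand (2 + n)) ⟩
    ℕ→ℚ (suc k) ℚ.* (ℕ→ℚ w ℚ.* alternatingSum summand (2 + n))
      ≡⟨ solve 3 (λ s w x → s :* (w :* x) := w :* (s :* x)) refl (ℕ→ℚ (suc k)) (ℕ→ℚ w) _ ⟩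
    ℕ→ℚ w ℚ.* (ℕ→ℚ (suc k) ℚ.* alternatingSum summand (2 + n))
      ≡⟨ cong (ℕ→ℚ w ℚ.*_) (stirling-log n k) ⟩
    ℕ→ℚ w ℚ.* ℕ→ℚ (suc n * S n k) ≡⟨ ℕ→ℚ-* w (suc n * S n k) ⟨
    ℕ→ℚ (w * (suc n * S n k)) ∎

-- Local divisibility

local-∣ : ∀ {p} → Prime p → ∀ {a b} → a ∣ b → a ∣[ p ] b
local-∣ p-prime {a} {b} a∣b = 1 , ∤1 p-prime , subst (a ∣_) (sym (ℕ.*-identityˡ b)) a∣b

local-* : ∀ {p a b} w → a ∣[ p ] b → a ∣[ p ] (w * b)
local-* {_} {a} {b} w (u , p∤u , a∣ub) = u , p∤u , subst (a ∣_) (identity w u b) (∣n⇒∣m*n w a∣ub)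
  where
  identity : ∀ w u b → w * (u * b) ≡ u * (w * b)
  identity = ℕ-Solver.solve-∀

local-unit : ∀ {p a} b → ¬ p ∣ a → a ∣[ p ] b
local-unit {_} {a} b p∤a = a , p∤a , m∣m*n b

prime⇒1< : ∀ {p} → Prime p → 1 < p
prime⇒1< {p} p-prime = nonTrivial⇒n>1 p {{prime⇒nonTrivial p-prime}}

-- The prime p is coprime to `u`, so a common divisor of pb and ub divides b. This brings local
-- statements back to ℤ.
local-*⁻¹ : ∀ {p} → Prime p → ∀ {a b} → a ∣[ p ] b → a ∣ p * b → a ∣ b
local-*⁻¹ {p} p-prime (u , p∤u , a∣ub) a∣pb = coprime-factors coprime (a∣pb , a∣ub)
  where
  coprime : Coprime p u
  coprime (d∣p , d∣u) with prime⇒irreducible p-prime d∣p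
  ... | inj₁ d≡1  = d≡1
  ... | inj₂ refl = contradiction d∣u p∤u

p-part : ∀ {p} → Prime p → ∀ j → 0 < j → ∃ λ a → ∃ λ u → j ≡ p ^ a * u × ¬ p ∣ u
p-part {p} p-prime = <-rec _ step
  where
  P : ℕ → Set
  P j = 0 < j → ∃ λ a → ∃ λ u → j ≡ p ^ a * u × ¬ p ∣ u
  step : ∀ j → (∀ {i} → i < j → P i) → P j
  step j rec 0<j with p ∣? j
  ... | no p∤j = 0 , j , sym (ℕ.+-identityʳ j) , p∤j
  ... | yes (divides zero refl) with () ← 0<j
  ... | yes (divides i@(suc _) refl)
    with rec (ℕ.m<m*n i p (prime⇒1< p-prime)) (s≤s z≤n)
  ... | a , u , eq , p∤u = suc a , u , trans (cong (_* p) eq) (identity (p ^ a) u p) , p∤u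
    where
    identity : ∀ x u p → x * u * p ≡ p * x * u
    identity = ℕ-Solver.solve-∀

-- If pᵃ is the exact power of p dividing i + 1 and a ≥ 1, then pᵃ⁻¹ ≤ i, so pᵃ⁻¹ divides i!.
suc∣p*! : ∀ {p} → Prime p → ∀ i → suc i ∣[ p ] (p * i !)
suc∣p*! {p} p-prime i with p-part p-prime (suc i) (s≤s z≤n)
... | zero  , u , eq , p∤u =
  local-unit (p * i !) (subst (λ t → ¬ p ∣ t) (sym (trans eq (ℕ.+-identityʳ u))) p∤u)
... | suc a , zero , eq , p∤u = contradiction (p ∣0) p∤u
... | suc a , u@(suc v) , eq , p∤u = u , p∤u ,
    subst (_∣ u * (p * i !)) (sym (trans eq (ℕ.*-comm (p ^ suc a) u)))
      (*-monoʳ-∣ u (*-monoʳ-∣ p (∣-trans (n∣n! (p ^ a)) (m≤n⇒m!∣n! pᵃ≤i))))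
  where
  instance
    nz : NonZero (p ^ a)
    nz = ℕ.m^n≢0 p a {{prime⇒nonZero p-prime}}
  n∣n! : ∀ n .{{_ : NonZero n}} → n ∣ n !
  n∣n! (suc n) = m∣m*n (n !)
  pᵃ≤i : p ^ a ≤ i
  pᵃ≤i = s≤s⁻¹ (ℕ.<-≤-trans (ℕ.m<m*n (p ^ a) p (prime⇒1< p-prime))
    (ℕ.≤-trans (ℕ.≤-reflexive (ℕ.*-comm (p ^ a) p))
    (ℕ.≤-trans (ℕ.m≤m*n (p * p ^ a) u) (ℕ.≤-reflexive (sym eq)))))

numerator-zero : ∀ {n} k i → S (suc n) (suc (k + i)) ≡ 0 → numerator n k i ≡ 0
numerator-zero k i eq = trans
  (cong (λ t → ((suc k + i) C i) * t) (trans (cong (i ! *_) eq) (ℕ.*-zeroʳ (i !))))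
  (ℕ.*-zeroʳ ((suc k + i) C i))

∣numerator : ∀ {a n} k i → a ∣ S (suc n) (suc (k + i)) → a ∣ numerator n k i
∣numerator k i a∣S = ∣n⇒∣m*n ((suc k + i) C i) (∣n⇒∣m*n (i !) a∣S)

-- The factor p, together with the i! in the numerator, makes up for the denominator i + 1 of every
-- term.
suc∣p*stirling : ∀ {p} → Prime p → ∀ n k → suc k ∣[ p ] (p * (suc n * S n k))
suc∣p*stirling {p} p-prime n k = stirling-local p-prime p n k λ i →
  subst (suc i ∣[ p ]_) (identity ((suc k + i) C i) (i !) p (S (suc n) (suc (k + i))))
    (local-* (((suc k + i) C i) * S (suc n) (suc (k + i))) (suc∣p*! p-prime i))
  where
  identity : ∀ c f p s → (c * s) * (p * f) ≡ p * (c * (f * s))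
  identity = ℕ-Solver.solve-∀

-- Whichever of k + 1 and i + 1 is prime to p is a unit at p, so only the terms with both divisible
-- by p need an argument.
suc∣stirling-local : ∀ {p} → Prime p → ∀ n k →
  (∀ i → p ∣ suc k → p ∣ suc i → suc i ∣[ p ] numerator n k i) → suc k ∣[ p ] (suc n * S n k)
suc∣stirling-local {p} p-prime n k div = by-cases (p ∣? suc k)
  where
  by-cases : Dec (p ∣ suc k) → suc k ∣[ p ] (suc n * S n k)
  by-cases (no p∤k)  = local-unit (suc n * S n k) p∤k
  by-cases (yes p∣k) = subst (suc k ∣[ p ]_) (ℕ.*-identityˡ (suc n * S n k))
    (stirling-local p-prime 1 n k λ i → local-* 1 (term i (p ∣? suc i)))
    where
    term : ∀ i → Dec (p ∣ suc i) → suc i ∣[ p ] numerator n k i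
    term i (no p∤i)  = local-unit (numerator n k i) p∤i
    term i (yes p∣i) = div i p∣k p∣i

-- In a critical term (k + 1) + (i + 1) ≥ 2p > n + 2, so k + 1 + i > n + 1 and the Stirling number
-- is 0.
suc∣stirling-below-2p : ∀ {p} → Prime p → ∀ n → n + 2 < 2 * p → ∀ k → suc k ∣[ p ] (suc n * S n k)
suc∣stirling-below-2p {p} p-prime n n+2<2p k = suc∣stirling-local p-prime n k λ i p∣k p∣i →
  subst (suc i ∣[ p ]_) (sym (numerator-zero {n} k i (stirling-above 0 (large i p∣k p∣i))))
    (local-∣ p-prime (suc i ∣0))
  where
  large : ∀ i → p ∣ suc k → p ∣ suc i → suc n < suc (k + i)
  large i p∣k p∣i = s≤s⁻¹ (ℕ.≤-trans (ℕ.≤-trans (ℕ.≤-reflexive (cong suc (ℕ.+-comm 2 n))) n+2<2p)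
    (ℕ.≤-trans (ℕ.+-mono-≤ (∣⇒≤ p∣k) (ℕ.≤-trans (ℕ.≤-reflexive (ℕ.+-identityʳ p)) (∣⇒≤ p∣i)))
      (ℕ.≤-reflexive (cong suc (ℕ.+-suc k i)))))

-- As n + 1 is even and k = 2p - 1 is odd, the degree n + 1 - k is odd if k ≤ n + 1, and the
-- reflection gives 2p ∣ 2 S(n + 1, k).
p∣stirling : ∀ {p} n → ¬ 2 ∣ n → ∀ k → suc k ≡ 2 * p → p ∣ S (suc n) k
p∣stirling {p} n n-odd k eq with k ≤? suc n
... | no k≰n = subst (p ∣_) (sym (stirling-above 0 (ℕ.≰⇒> k≰n))) (p ∣0)
... | yes k≤n = by-parity (halve (suc n ∸ k)) (ℕ.m+[n∸m]≡n k≤n)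
  where
  by-parity : ∀ {r} → Halved r → k + r ≡ suc n → p ∣ S (suc n) k
  by-parity (odd s)  k+r≡ = *-cancelˡ-∣ 2 (subst (_∣ 2 * S (suc n) k) eq
    (subst (λ m → suc k ∣ 2 * S m k) k+r≡ (suc∣2*stirling k s)))
  by-parity (even s) k+r≡ = contradiction (∣m+n∣m⇒∣n
    (subst (2 ∣_) (cong suc k+r≡)
      (subst (λ t → 2 ∣ t + s * 2) (sym eq) (∣m∣n⇒∣m+n (m∣m*n p) (n∣m*n s)))) ∣-refl) n-odd

-- Let k + 1 = ap and i + 1 = bp. If a + b ≥ 3, the Stirling number is 0 by size, which leaves a = b
-- = 1.
suc∣stirling-below-3p : ∀ {p} → Prime p → ∀ n → ¬ 2 ∣ n → n + 2 < 3 * p →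
  ∀ k → suc k ∣[ p ] (suc n * S n k)
suc∣stirling-below-3p {p} p-prime n n-odd n+2<3p k = suc∣stirling-local p-prime n k term
  where
  vanishing : ∀ i → 3 * p ≤ suc k + suc i → suc i ∣[ p ] numerator n k i
  vanishing i 3p≤ = subst (suc i ∣[ p ]_) (sym (numerator-zero {n} k i (stirling-above 0
    (s≤s⁻¹ (ℕ.≤-trans (ℕ.≤-trans (ℕ.≤-reflexive (cong suc (ℕ.+-comm 2 n))) n+2<3p)
      (ℕ.≤-trans 3p≤ (ℕ.≤-reflexive (cong suc (ℕ.+-suc k i)))))))))
    (local-∣ p-prime (suc i ∣0))
  term : ∀ i → p ∣ suc k → p ∣ suc i → suc i ∣[ p ] numerator n k i
  term i (divides zero ())          _
  term i (divides (suc a) k≡)       (divides zero ())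
  -- Here k + 1 = i + 1 = p, and the Stirling index k + 1 + i is 2p - 1.
  term i (divides (suc zero) k≡)    (divides (suc zero) i≡) = local-∣ p-prime
    (subst (_∣ numerator n k i) (sym (trans i≡ (ℕ.+-identityʳ p)))
      (∣numerator {n = n} k i (p∣stirling n n-odd (suc (k + i))
        (trans (cong suc (sym (ℕ.+-suc k i))) (trans (cong₂ _+_ k≡ i≡) (identity p))))))
    where
    identity : ∀ p → 1 * p + 1 * p ≡ 2 * p
    identity = ℕ-Solver.solve-∀
  term i (divides (suc (suc a)) k≡) (divides (suc b) i≡) = vanishing i
    (ℕ.≤-trans (ℕ.≤-trans (ℕ.m≤m+n (3 * p) (a * p + b * p)) (ℕ.≤-reflexive (identity p a b)))
      (ℕ.≤-reflexive (sym (cong₂ _+_ k≡ i≡))))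
    where
    identity : ∀ p a b → 3 * p + (a * p + b * p) ≡ suc (suc a) * p + suc b * p
    identity = ℕ-Solver.solve-∀
  term i (divides (suc zero) k≡)    (divides (suc (suc b)) i≡) = vanishing i
    (ℕ.≤-trans (ℕ.≤-trans (ℕ.m≤m+n (3 * p) (b * p)) (ℕ.≤-reflexive (identity p b)))
      (ℕ.≤-reflexive (sym (cong₂ _+_ k≡ i≡))))
    where
    identity : ∀ p b → 3 * p + b * p ≡ 1 * p + suc (suc b) * p
    identity = ℕ-Solver.solve-∀

-- The prime 2

parity≡0⇒2∣ : ∀ n → parity n ≡ 0ℙ → 2 ∣ n
parity≡0⇒2∣ n eq with halve n
... | even k = n∣m*n k
... | odd k with () ← trans (sym eq) (parity-suc-double k)

2∣⇒parity≡0 : ∀ {n} → 2 ∣ n → parity n ≡ 0ℙ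
2∣⇒parity≡0 (divides k refl) = parity-double k

2∤odd : ∀ k → ¬ 2 ∣ suc (k * 2)
2∤odd k 2∣ with () ← trans (sym (2∣⇒parity≡0 2∣)) (parity-suc-double k)

suc∣numerator-even : ∀ n k i → 2 ∣ S (suc n) (suc (k + i)) → suc i ∣[ 2 ] numerator n k i
suc∣numerator-even n k i (divides s eq) = subst (suc i ∣[ 2 ]_)
  (trans (identity ((suc k + i) C i) (i !) s)
    (cong (λ t → ((suc k + i) C i) * (i ! * t)) (sym eq)))
  (local-* (((suc k + i) C i) * s) (suc∣p*! prime[2] i))
  where
  identity : ∀ c f s → (c * s) * (2 * f) ≡ c * (f * (s * 2))
  identity = ℕ-Solver.solve-∀

-- For odd k and i the index k + 1 + i is odd and at least 3, so modulo 2 the Stirling number is a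
-- nonconstant coefficient of the Fibonacci polynomial of index 2ʳ.
suc∣stirling-2^r : ∀ n r → suc n ≡ 2 ^ r → ∀ k → suc k ∣[ 2 ] (suc n * S n k)
suc∣stirling-2^r n r n≡ k = suc∣stirling-local prime[2] n k term
  where
  term : ∀ i → 2 ∣ suc k → 2 ∣ suc i → suc i ∣[ 2 ] numerator n k i
  term i 2∣k 2∣i with halve k | halve i
  ... | even a | _      = contradiction 2∣k (2∤odd a)
  ... | odd a  | even b = contradiction 2∣i (2∤odd b)
  ... | odd a  | odd b  = suc∣numerator-even n (suc (a * 2)) (suc (b * 2))
    (parity≡0⇒2∣ _ (trans (cong (λ t → parity (S (suc n) t)) (identity a b))
      (trans (stirling-parity (suc n) (suc (a + b)))
        (trans (cong (λ m → fibonacci m (suc (a + b))) n≡) (fibonacci-2^r r (a + b))))))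
    where
    identity : ∀ a b → suc (suc (a * 2) + suc (b * 2)) ≡ suc (suc (a + b) * 2)
    identity = ℕ-Solver.solve-∀

-- Downward induction on u: for k = 2u + 1, the term i = 1 is the only one that could fail
-- to be 2-integral.
stirling-odd-even : ∀ n {q} → ¬ 2 ∣ q → (∀ k → suc k ∣ q * (suc n * S n k)) →
  ∀ u → 2 ∣ S (suc n) (suc (suc u * 2))
stirling-odd-even n {q} 2∤q div u = descend (suc n) u (ℕ.m≤m+n (suc n) u)
  where
  -- The distance from u to n + 1 is at most `j`; for j = 0 the index 2u + 3 exceeds n + 1.
  descend : ∀ j u → suc n ≤ j + u → 2 ∣ S (suc n) (suc (suc u * 2))
  descend zero    u n<u = subst (2 ∣_) (sym (stirling-above 0
    (s≤s (ℕ.≤-trans n<u (ℕ.≤-trans (ℕ.m≤m*n u 2) (ℕ.m≤n+m (u * 2) 2)))))) (2 ∣0)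
  descend (suc j) u n<u =
    [ (λ 2∣v → contradiction 2∣v 2∤v) , numerator-even ]′ (euclidsLemma v _ prime[2] 2∣vy)
    where
    k = suc (u * 2)
    t : ℕ → ℚ
    t i = recip i ℚ.* ℕ→ℚ (numerator n k i)
    term : ∀ i → suc i ∣[ 2 ] numerator n k i → Integral 2 (t i)
    term i = ∣⇒integral {i = i} (suc*recip* i (ℕ→ℚ (numerator n k i)))
    -- From index 2 on, a term of even index has an odd denominator. One of odd index involves S(n +
    -- 1, 2v + 1) with v > u + 1, which is even by induction.
    higher : ∀ i → Integral 2 (t (2 + i))
    higher i = term (2 + i) (higher-∣ (halve i))
      where
      identity : ∀ u j → suc (suc (u * 2) + (2 + suc (j * 2))) ≡ suc (suc (suc (u + j)) * 2)
      identity = ℕ-Solver.solve-∀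
      higher-∣ : ∀ {i} → Halved i → (3 + i) ∣[ 2 ] numerator n k (2 + i)
      higher-∣ (even j′) = local-unit (numerator n k (2 + j′ * 2)) (2∤odd (suc j′))
      higher-∣ (odd j′)  = suc∣numerator-even n k (2 + suc (j′ * 2))
        (subst (λ l → 2 ∣ S (suc n) l) (sym (identity u j′)) (descend j (suc (u + j′))
          (ℕ.≤-trans n<u (ℕ.≤-trans (ℕ.+-monoʳ-≤ (suc j) (ℕ.m≤m+n u j′))
            (ℕ.≤-reflexive (sym (ℕ.+-suc j (u + j′))))))))
    total : Integral 2 (alternatingSum t (2 + n))
    total = ∣⇒integral (stirling-log n k) (q , 2∤q , div k)
    rest : ℚ
    rest = alternatingSum (λ i → t (2 + i)) n
    -- The whole sum is t 0 - t 1 + `rest`, so t 1 is a combination of 2-integral numbers.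
    isolate : t 0 ℚ.- (alternatingSum t (2 + n) ℚ.- rest) ≡ t 1
    isolate = solve 3 (λ a b r → a :- ((a :- (b :- r)) :- r) := b) refl (t 0) (t 1) rest
    2∣[2]y : 2 ∣[ 2 ] numerator n k 1
    2∣[2]y = integral⇒∣ {i = 1} (suc*recip* 1 (ℕ→ℚ (numerator n k 1))) (subst (Integral 2) isolate
      (integral-- prime[2] (term 0 (local-unit _ (∤1 prime[2])))
        (integral-- prime[2] total
          (integral-alternatingSum prime[2] (λ i → t (2 + i)) n higher))))
    v = proj₁ 2∣[2]y
    2∤v = proj₁ (proj₂ 2∣[2]y)
    2∣vy = proj₂ (proj₂ 2∣[2]y)
    index : k + 1 ≡ suc u * 2
    index = ℕ.+-comm k 1
    numerator-even : 2 ∣ numerator n k 1 → 2 ∣ S (suc n) (suc (suc u * 2))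
    -- The binomial coefficient C(k + 2, 1) = 2u + 3 is odd, so the factor 2 lies in the Stirling
    -- number.
    numerator-even 2∣y = [ (λ 2∣C → contradiction (subst (2 ∣_)
        (trans (nC1≡n (suc k + 1)) (cong suc index)) 2∣C) (2∤odd (suc u)))
      , subst (2 ∣_) (trans (ℕ.*-identityˡ _) (cong (λ l → S (suc n) (suc l)) index)) ]′
      (euclidsLemma ((suc k + 1) C 1) (1 ! * S (suc n) (suc (k + 1))) prime[2] 2∣y)

odd⇒2^r : ∀ n {q} → ¬ 2 ∣ q → (∀ k → suc k ∣ q * (suc n * S n k)) → ∃ λ r → suc n ≡ 2 ^ r
odd⇒2^r n 2∤q div = fibonacci-constant⇒2^r (suc n) (s≤s z≤n) λ u →
  trans (sym (stirling-parity (suc n) (suc u))) (2∣⇒parity≡0 (stirling-odd-even n 2∤q div u))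

2∣2^r : ∀ {n} → 1 ≤ n → (∃ λ r → suc n ≡ 2 ^ r) → 2 ∣ suc n
2∣2^r 1≤n (zero  , eq) = contradiction (ℕ.suc-injective eq) (ℕ.<⇒≢ 1≤n ∘ sym)
2∣2^r 1≤n (suc r , eq) = subst (2 ∣_) (sym eq) (m∣m*n (2 ^ r))

2∣*suc : ∀ n {q} → (∀ k → suc k ∣ q * (suc n * S n k)) → 1 ≤ n → 2 ∣ q * suc n
2∣*suc n {q} div 1≤n with 2 ∣? q
... | yes 2∣q = ∣m⇒∣m*n (suc n) 2∣q
... | no 2∤q  = ∣n⇒∣m*n q (2∣2^r 1≤n (odd⇒2^r n 2∤q div))

prime-divisor : ∀ m → 1 < m → ∃ λ p → Prime p × p ∣ m
prime-divisor m@(suc _) 1<m with factorise m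
... | record { factors = [] ; isFactorisation = eq } = contradiction (sym eq) (ℕ.<⇒≢ 1<m)
... | record { factors = p ∷ ps ; isFactorisation = eq ; factorsPrime = p-prime ∷ _ } =
  p , p-prime , subst (p ∣_) (sym eq) (m∣m*n _)

-- Minimality of the quotient

module _ (n q : ℕ) (0<q : 0 < q) (div : ∀ k → suc k ∣ q * (suc n * S n k))
  (least : ∀ q′ → 0 < q′ → (∀ k → suc k ∣ q′ * (suc n * S n k)) → q ≤ q′) where

  -- Otherwise q′ could replace q: divisibility by k + 1 holds in ℤ with the factor pq′ and locally
  -- at p with q′, hence in ℤ with q′.
  least-not-local : ∀ {p} → Prime p → ∀ q′ → q ≡ p * q′ →
    ¬ (∀ k → suc k ∣[ p ] (q′ * (suc n * S n k)))
  least-not-local {p} p-prime zero     eq _     =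
    contradiction (trans eq (ℕ.*-zeroʳ p)) (ℕ.<⇒≢ 0<q ∘ sym)
  least-not-local {p} p-prime q′@(suc _) eq local = ℕ.<⇒≱
    (ℕ.<-≤-trans (ℕ.m<m*n q′ p (prime⇒1< p-prime)) (ℕ.≤-reflexive (trans (ℕ.*-comm q′ p) (sym eq))))
    (least q′ (s≤s z≤n) λ k → local-*⁻¹ p-prime (local k)
      (subst (suc k ∣_) (trans (cong (_* (suc n * S n k)) eq) (ℕ.*-assoc p q′ (suc n * S n k)))
        (div k)))

  not-local : ∀ {p} → Prime p → p ∣ q → ¬ (∀ k → suc k ∣[ p ] (suc n * S n k))
  not-local {p} p-prime (divides q′ eq) local =
    least-not-local p-prime q′ (trans eq (ℕ.*-comm q′ p)) (λ k → local-* q′ (local k))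

  least-squarefree : Squarefree q
  least-squarefree zero          (divides w eq) =
    contradiction (trans eq (ℕ.*-zeroʳ w)) (ℕ.<⇒≢ 0<q ∘ sym)
  least-squarefree (suc zero)    _              = refl
  least-squarefree m@(suc (suc _)) (divides w eq) with prime-divisor m (s≤s (s≤s z≤n))
  -- With m = vp and q = wm², the cofactor of p in q is wv²p, which still has the factor p that
  -- `suc∣p*stirling` uses.
  ... | p , p-prime , divides v m≡ = contradiction
      (λ k → subst (suc k ∣[ p ]_) (sym (ℕ.*-assoc (w * v * v) p (suc n * S n k)))
        (local-* (w * v * v) (suc∣p*stirling p-prime n k)))
      (least-not-local p-prime (w * v * v * p)
        (trans eq (trans (cong (λ t → w * (t * t)) m≡) (identity w v p))))
    where
    identity : ∀ w v p → w * (v * p * (v * p)) ≡ p * (w * v * v * p)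
    identity = ℕ-Solver.solve-∀

-- The quotient is a separate parameter, so that d can be written as q(n + 1) and division of
-- natural numbers enters only at the end.
Conclusion : ℕ → ℕ → ℕ → Set
Conclusion n d q =
  (∀ p → Prime p → p ∣ d → p ≤ n + 1) ×
  (suc n ∣ d × Squarefree q) ×
  ((1 ≤ n → 2 ∣ d) × ((¬ (2 ∣ q)) ⇔ (∃ λ r → n ≡ 2 ^ r ∸ 1))) ×
  (∀ p → Prime p → p ∣ q → (2 ∣ n → 2 * p ≤ n + 2) × (¬ (2 ∣ n) → 3 * p ≤ n + 2))

conclusion : ∀ n (c : Vec ℚ (2 + n)) →
  (∀ x → evalPoly c (ℕ→ℚ (suc x)) ≡ ℕ→ℚ (powerSum n (suc x))) →
  ∀ q → IsLeastDenominator c (q * suc n) → Conclusion n (q * suc n) q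
conclusion n c interpolates q (0<d , clears , d-least) =
    (λ p p-prime p∣d → [ p≤n+1 p-prime ∘ 2p≤ p-prime , ∣⇒≤n+1 ]′ (euclidsLemma q (suc n) p-prime p∣d))
  , (n∣m*n q , least-squarefree n q 0<q div least)
  , (2∣*suc n {q} div , mk⇔ (λ 2∤q → map₂ (cong (_∸ 1)) (odd⇒2^r n {q} 2∤q div)) ⇒odd)
  , λ p p-prime p∣q → (λ _ → 2p≤ p-prime p∣q) , 3p≤ p-prime p∣q
  where
  0<q : 0 < q
  0<q = ℕ.n≢0⇒n>0 λ { refl → contradiction 0<d λ () }
  div : ∀ k → suc k ∣ q * (suc n * S n k)
  div k = subst (suc k ∣_) (ℕ.*-assoc q (suc n) (S n k))
    (clears⇒suc∣stirling n c interpolates {q * suc n} clears k)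
  least : ∀ q′ → 0 < q′ → (∀ k → suc k ∣ q′ * (suc n * S n k)) → q ≤ q′
  least q′ 0<q′ div′ = ℕ.*-cancelʳ-≤ q q′ (suc n) (d-least (q′ * suc n)
    (ℕ.*-mono-< 0<q′ (s≤s (z≤n {n})))
    (suc∣stirling⇒clears n c interpolates {q′ * suc n} λ k →
      subst (suc k ∣_) (sym (ℕ.*-assoc q′ (suc n) (S n k))) (div′ k)))
  2p≤ : ∀ {p} → Prime p → p ∣ q → 2 * p ≤ n + 2
  2p≤ p-prime p∣q = ℕ.≮⇒≥ λ n+2<2p →
    not-local n q 0<q div least p-prime p∣q (suc∣stirling-below-2p p-prime n n+2<2p)
  3p≤ : ∀ {p} → Prime p → p ∣ q → ¬ 2 ∣ n → 3 * p ≤ n + 2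
  3p≤ p-prime p∣q n-odd = ℕ.≮⇒≥ λ n+2<3p →
    not-local n q 0<q div least p-prime p∣q (suc∣stirling-below-3p p-prime n n-odd n+2<3p)
  p≤n+1 : ∀ {p} → Prime p → 2 * p ≤ n + 2 → p ≤ n + 1
  p≤n+1 {p} p-prime 2p≤n+2 = ℕ.+-cancelˡ-≤ 1 p (n + 1) (ℕ.≤-trans
    (ℕ.+-mono-≤ (ℕ.<⇒≤ (prime⇒1< p-prime)) (ℕ.≤-reflexive (sym (ℕ.+-identityʳ p))))
    (ℕ.≤-trans 2p≤n+2 (ℕ.≤-reflexive (ℕ.+-suc n 1))))
  ∣⇒≤n+1 : ∀ {p} → p ∣ suc n → p ≤ n + 1
  ∣⇒≤n+1 p∣1+n = ℕ.≤-trans (∣⇒≤ p∣1+n) (ℕ.≤-reflexive (ℕ.+-comm 1 n))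
  ⇒odd : (∃ λ r → n ≡ 2 ^ r ∸ 1) → ¬ 2 ∣ q
  ⇒odd (r , n≡) 2∣q = not-local n q 0<q div least prime[2] 2∣q
    (suc∣stirling-2^r n r (trans (cong suc n≡) (ℕ.m+[n∸m]≡n (ℕ.m^n>0 2 r))))

theorem1 : (n : ℕ) (c : Vec ℚ (2 + n)) →
    (∀ x → evalPoly c (ℕ→ℚ (suc x)) ≡ ℕ→ℚ (powerSum n (suc x))) →
    (d : ℕ) → IsLeastDenominator c d →
    (∀ p → Prime p → p ∣ d → p ≤ n + 1) ×
    (suc n ∣ d × Squarefree (d / suc n)) ×
    ((1 ≤ n → 2 ∣ d) × ((¬ (2 ∣ (d / suc n))) ⇔ (∃ λ r → n ≡ 2 ^ r ∸ 1))) ×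
    (∀ p → Prime p → p ∣ (d / suc n) →
    (2 ∣ n → 2 * p ≤ n + 2) × (¬ (2 ∣ n) → 3 * p ≤ n + 2))
theorem1 n c interpolates d d-least = by-quotient d d-least
  -- The criterion at k = n, where S(n, n) = 1, yields the divisor n + 1.
  (subst (suc n ∣_) (trans (cong (d *_) (stirling-diagonal 0 n)) (ℕ.*-identityʳ d))
    (clears⇒suc∣stirling n c interpolates {d} (proj₁ (proj₂ d-least)) n))
  where
  by-quotient : ∀ d → IsLeastDenominator c d → suc n ∣ d → Conclusion n d (d / suc n)
  by-quotient _ d-least (divides q refl) =
    subst (Conclusion n (q * suc n)) (sym (m*n/n≡m q (suc n)))
      (conclusion n c interpolates q d-least)
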